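{- Let $p>3$ be a prime. Then \[ \sum_{k=1}^{p-1}k^2H_k^2\equiv\frac{79}{108}p-\frac{4}{9}\pmod{p^2},\qquad \sum_{k=1}^{p-1}k^3H_k^2\equiv-\frac{59}{144}p+\frac{1}{6}\pmod{p^2}. \] Moreover, for every integer $m$ with $0<m<p-1$: if $m$ is odd and $m\neq3$, then $\sum_{k=1}^{p-1}k^mH_k^2\equiv B_{m-1}+p\mu_m\pmod{p^2}$; if $m$ is even and $m\ne 2$, then $\sum_{k=1}^{p-1}k^mH_k^2\equiv \nu_m+p\lambda_m\pmod{p^2}$, where \[ \mu_m=-\frac{m+2}{2m}S(m-1)+\frac{1}{4}\sum_{r=0}^{m-1}B_rB_{m-1-r},\qquad \nu_m=-\frac{2}{m+1}S(m), \] \[ \lambda_m=\frac{2}{m+1}\sum_{r=0}^{m}\frac{\binom{m+1}{r}}{m+1-r}B_rS(m-r)-\frac{m^2-m+6}{12}B_{m-2}, \] and $S(n)=\sum_{r=0}^{n}\binom{n+1}{r}B_rB_{n-r}$.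
   Context: $H_n=\sum_{i=1}^n 1/i$ are the harmonic numbers. $B_0,B_1,B_2,\dots$ are the Bernoulli numbers defined by $B_0=1$ and $\sum_{k=0}^n\binom{n+1}{k}B_k=0$ for $n\ge1$ (so $B_1=-1/2$). For rationals $a,b$ whose denominators are coprime to $p$, $a\equiv b\pmod{p^e}$ means that $a-b$, written in lowest terms, has numerator divisible by $p^e$. -}

module Defs where

open import Data.Nat as ℕ using (ℕ; zero; suc; _∸_)
open import Data.Nat.Combinatorics using (_C_)
open import Data.Nat.Divisibility as ND using ()
open import Data.Integer as ℤ using (ℤ; +_)
open import Data.Rational using (ℚ; ↥_; ↧ₙ_; _/_; _+_; _*_; _-_; -_; 0ℚ; 1ℚ)
open import Data.List using (List; []; _∷_; _++_; [_]; length)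
open import Relation.Nullary using (¬_)
open import Data.Product using (_×_)

ℕ→ℚ : ℕ → ℚ
ℕ→ℚ n = (+ n) / 1

∑₁ : ℕ → (ℕ → ℚ) → ℚ
∑₁ zero    f = 0ℚ
∑₁ (suc n) f = ∑₁ n f + f (suc n)

∑₀ : ℕ → (ℕ → ℚ) → ℚ
∑₀ zero    f = f 0
∑₀ (suc n) f = ∑₀ n f + f (suc n)

H : ℕ → ℚ
H n = ∑₁ n (λ i → harm i)
  where
  harm : ℕ → ℚ
  harm zero    = 0ℚ
  harm (suc i) = (+ 1) / suc i

-- Bernoulli numbers.  bernList n = [B_0, ..., B_{n-1}].
-- Recurrence: B_0 = 1, and for n ≥ 1,
--   Σ_{k=0}^{n} C(n+1,k) B_k = 0, i.e. B_n = -(1/(n+1)) Σ_{k<n} C(n+1,k) B_k.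
private
  weighted : ℕ → ℕ → List ℚ → ℚ
  weighted N k []       = 0ℚ
  weighted N k (b ∷ bs) = ℕ→ℚ (N C k) * b + weighted N (suc k) bs

  nextB : List ℚ → ℚ
  nextB l = - (((+ 1) / suc (length l)) * weighted (suc (length l)) 0 l)

bernList : ℕ → List ℚ
bernList zero          = []
bernList (suc zero)    = 1ℚ ∷ []
bernList (suc (suc n)) = bernList (suc n) ++ [ nextB (bernList (suc n)) ]

private
  lastOr0 : List ℚ → ℚ
  lastOr0 []           = 0ℚ
  lastOr0 (x ∷ [])     = x
  lastOr0 (x ∷ y ∷ xs) = lastOr0 (y ∷ xs)

-- B n = B_n  (so B 1 = -1/2)
B : ℕ → ℚ
B n = lastOr0 (bernList (suc n))

_≡_[mod_^_] : ℚ → ℚ → ℕ → ℕ → Set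
a ≡ b [mod p ^ e ] =
  ¬ (p ND.∣ ↧ₙ a) × ¬ (p ND.∣ ↧ₙ b) × ((p ℕ.^ e) ND.∣ ℤ.∣ ↥ (a - b) ∣)

S : ℕ → ℚ
S n = ∑₀ n (λ r → ℕ→ℚ (suc n C r) * B r * B (n ∸ r))

μ : ℕ → ℚ
μ zero = 0ℚ
μ (suc n) = - (((+ (suc n ℕ.+ 2)) / (2 ℕ.* suc n)) * S n)
            + ((+ 1) / 4) * ∑₀ n (λ r → B r * B (n ∸ r))

ν : ℕ → ℚ
ν m = - (((+ 2) / suc m) * S m)

λ′ : ℕ → ℚ
λ′ m = ((+ 2) / suc m) * ∑₀ m (λ r → ((+ (suc m C r)) / suc (m ∸ r)) * B r * S (m ∸ r))
       - ((+ (m ℕ.* m ∸ m ℕ.+ 6)) / 12) * B (m ∸ 2)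

T : ℕ → ℕ → ℚ
T p m = ∑₁ (p ∸ 1) (λ k → ℕ→ℚ (k ℕ.^ m) * H k * H k)

{-# OPTIONS --safe #-}
module Submission where

open import Defs
open import Data.Nat as ℕ using (ℕ; _<_; _∸_; _%_)
open import Data.Nat.Primality using (Prime)
open import Data.Integer using (+_; -[1+_])
open import Data.Rational using (_/_; _+_; _*_; _-_)
open import Data.Product using (_×_)
open import Relation.Binary.PropositionalEquality using (_≡_; _≢_)

open import Data.Empty using (⊥-elim)
import Data.Integer as ℤ
open import Data.Integer using (ℤ)
import Data.Integer.Properties as ℤ
open import Data.List using (List; []; _∷_; _++_; [_]; length)
open import Data.List.Properties using (length-++)
open import Data.Nat using (zero; suc; _≤_; z≤n; s≤s)
open import Data.Nat.Combinatorics using (_C_; nCk+nC[k+1]≡[n+1]C[k+1]; nCk≡nC[n∸k]; nCn≡1; nC1≡n; k>n⇒nCk≡0)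
import Data.Nat.Coprimality as Coprimality
open import Data.Nat.Divisibility using (_∣_; divides; ∣-refl; ∣-trans; ∣m⇒∣m*n; ∣n⇒∣m*n; m∣m*n; *-cancelˡ-∣; *-monoʳ-∣; >⇒∤; ∣1⇒≡1; 1∣_)
open import Data.Nat.Primality using (euclidsLemma; prime⇒nonZero; ¬prime[1])
import Data.Nat.Properties as ℕ
open import Data.Nat.Tactic.RingSolver using () renaming (solve-∀ to ℕ-solve-∀)
open import Data.Product using (_,_)
open import Data.Rational using (ℚ; mkℚ; 0ℚ; 1ℚ; ½; -_; ↥_; ↧ₙ_; toℚᵘ; _≟_)
open import Data.Rational.Properties
  using (toℚᵘ-injective; toℚᵘ-fromℚᵘ; toℚᵘ-homo-+; toℚᵘ-homo-*; ↥p/↧p≡p; +-*-commutativeRing;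
         +-assoc; +-comm; +-identityˡ; +-identityʳ; *-assoc; *-comm; *-identityˡ; *-identityʳ; *-zeroˡ; *-zeroʳ)
open import Data.Rational.Unnormalised as ℚᵘ using (mkℚᵘ; *≡*)
import Data.Rational.Unnormalised.Properties as ℚᵘ
open import Data.Sum using (_⊎_; inj₁; inj₂; [_,_]′)
open import Function using (_∘_)
open import Relation.Binary.PropositionalEquality using (_≗_; refl; sym; trans; cong; cong₂; subst; module ≡-Reasoning)
open import Relation.Nullary using (¬_)
open import Relation.Nullary.Decidable using (dec⇒maybe)
open import Tactic.RingSolver using (solve-∀)
open import Tactic.RingSolver.Core.AlmostCommutativeRing using (AlmostCommutativeRing; fromCommutativeRing)
open ≡-Reasoning

-- With F n = Σ_{j<n} jᵐ, which by Faulhaber's formula is n G(n) for a polynomial G with coefficients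
-- C(m+1,r) B_r / (m+1), summation by parts gives
--   Σ_{k<p} kᵐ H_k² = F(p) H_{p-1}² - Σ_{k<p} G(k) (2 H_k - 1/k).
-- The sums Σ kⁿ H_k are treated in the same way, H_{p-1} vanishes mod p² by Wolstenholme's theorem, and
-- Σ_{k<p} kʲ = p B_j - [j = 0] mod p².  This gives, for all 0 < m < p - 1,
--   Σ kᵐ H_k² = ν_m - (m/2) B_{m-1} + p (2/(m+1) L_m + 1/(m+1) Σ_{r<m} C(m+1,r) B_r B_{m-1-r}) mod p²,
-- where L_m is the sum over r in λ_m.  The rest is exact: the parity of the Bernoulli numbers collapses
-- the sums, and for odd m Matiyasevich's identity (n+2) Σ B_r B_{n-r} = 2 Σ C(n+2,r) B_r B_{n-r}, valid for
-- even n ≠ 2, turns the coefficient of p into μ_m.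

-- The bound m < p - 1 keeps every division prime to p: for n ≤ p - 2 the recurrence of B_n divides
-- only by integers at most p - 1, and so do 1/(m+1) and the weights 1/(m+1-r) of L_m. The factor n
-- in Faulhaber's formula serves twice: at n = p it lifts knowledge of G(p) mod p to mod p², and
-- against the jump 1/k of H_k it leaves the polynomial G(k). The exceptional exponents come from
-- B_1, the only nonzero Bernoulli number of odd index. It enters through B_{m-1} when m = 2 and
-- through B_{m-2} when m = 3; there the general congruence is evaluated numerically. Two products
-- of sequences occur: the binomial one, for which B is t/(eᵗ - 1), and the plain convolution in
-- μ_m. Matiyasevich's identity links them, because the binomial transform (multiplication by eᵗ) of
-- a shifted plain convolution is the convolution of the transformed factors.

ℚ-ring : AlmostCommutativeRing _ _
ℚ-ring = fromCommutativeRing +-*-commutativeRing (λ x → dec⇒maybe (0ℚ ≟ x))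

+-congˡ : ∀ (x : ℚ) {y z} → y ≡ z → x + y ≡ x + z
+-congˡ x = cong (λ y → x + y)

-- Integers in ℚ

-- Arithmetic in ℚ normalises by gcds; in the unnormalised rationals the following identities are
-- mere cross multiplications.
toℚᵘ-/1 : ∀ i → toℚᵘ (i / 1) ℚᵘ.≃ mkℚᵘ i 0
toℚᵘ-/1 i = toℚᵘ-fromℚᵘ (mkℚᵘ i 0)

/1-+ : ∀ i j → (i ℤ.+ j) / 1 ≡ i / 1 + j / 1
/1-+ i j = toℚᵘ-injective (ℚᵘ.≃-trans (toℚᵘ-/1 (i ℤ.+ j)) (ℚᵘ.≃-trans eq (ℚᵘ.≃-sym (ℚᵘ.≃-trans (toℚᵘ-homo-+ (i / 1) (j / 1)) (ℚᵘ.+-cong (toℚᵘ-/1 i) (toℚᵘ-/1 j))))))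
  where
  eq : mkℚᵘ (i ℤ.+ j) 0 ℚᵘ.≃ mkℚᵘ i 0 ℚᵘ.+ mkℚᵘ j 0
  eq = *≡* (cong (ℤ._* + 1) (sym (cong₂ ℤ._+_ (ℤ.*-identityʳ i) (ℤ.*-identityʳ j))))

/1-* : ∀ i j → (i ℤ.* j) / 1 ≡ (i / 1) * (j / 1)
/1-* i j = toℚᵘ-injective (ℚᵘ.≃-trans (toℚᵘ-/1 (i ℤ.* j)) (ℚᵘ.≃-sym (ℚᵘ.≃-trans (toℚᵘ-homo-* (i / 1) (j / 1)) (ℚᵘ.*-cong (toℚᵘ-/1 i) (toℚᵘ-/1 j)))))

/1-injective : ∀ {i j} → i / 1 ≡ j / 1 → i ≡ j
/1-injective {i} {j} eq with ℚᵘ.≃-trans (ℚᵘ.≃-sym (toℚᵘ-/1 i)) (ℚᵘ.≃-trans (ℚᵘ.≃-reflexive (cong toℚᵘ eq)) (toℚᵘ-/1 j))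
... | *≡* h = trans (sym (ℤ.*-identityʳ i)) (trans h (ℤ.*-identityʳ j))

/-*-cancel : ∀ i d .{{_ : ℕ.NonZero d}} → (i / d) * ℕ→ℚ d ≡ i / 1
/-*-cancel i (suc d) = toℚᵘ-injective (ℚᵘ.≃-trans (toℚᵘ-homo-* (i / suc d) (+ suc d / 1)) (ℚᵘ.≃-trans (ℚᵘ.*-cong (toℚᵘ-fromℚᵘ (mkℚᵘ i d)) (toℚᵘ-/1 (+ suc d))) (ℚᵘ.≃-trans (*≡* eq) (ℚᵘ.≃-sym (toℚᵘ-/1 i)))))
  where
  eq : (i ℤ.* + suc d) ℤ.* + 1 ≡ i ℤ.* + (suc d ℕ.* 1)
  eq = trans (ℤ.*-identityʳ _) (cong (λ x → i ℤ.* + x) (sym (ℕ.*-identityʳ (suc d))))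

ℕ→ℚ-+ : ∀ m n → ℕ→ℚ (m ℕ.+ n) ≡ ℕ→ℚ m + ℕ→ℚ n
ℕ→ℚ-+ m n = /1-+ (+ m) (+ n)

ℕ→ℚ-* : ∀ m n → ℕ→ℚ (m ℕ.* n) ≡ ℕ→ℚ m * ℕ→ℚ n
ℕ→ℚ-* m n = trans (cong (_/ 1) (ℤ.pos-* m n)) (/1-* (+ m) (+ n))

ℕ→ℚ-suc : ∀ n → ℕ→ℚ (suc n) ≡ 1ℚ + ℕ→ℚ n
ℕ→ℚ-suc n = ℕ→ℚ-+ 1 n

-- This restates the function local to `H`, so that H (k+1) unfolds to H k + rec (k+1).
rec : ℕ → ℚ
rec zero    = 0ℚ
rec (suc n) = + 1 / suc n

rec-inverseˡ : ∀ n → rec (suc n) * ℕ→ℚ (suc n) ≡ 1ℚ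
rec-inverseˡ n = /-*-cancel (+ 1) (suc n)

*-cancel-suc : ∀ n {x y} → ℕ→ℚ (suc n) * x ≡ ℕ→ℚ (suc n) * y → x ≡ y
*-cancel-suc n {x} {y} h = begin
  x                                   ≡⟨ expand x ⟩
  rec (suc n) * (ℕ→ℚ (suc n) * x)     ≡⟨ cong (rec (suc n) *_) h ⟩
  rec (suc n) * (ℕ→ℚ (suc n) * y)     ≡⟨ expand y ⟨
  y                                   ∎
  where
  expand : ∀ z → z ≡ rec (suc n) * (ℕ→ℚ (suc n) * z)
  expand z = trans (sym (*-identityˡ z)) (trans (cong (_* z) (sym (rec-inverseˡ n))) (*-assoc (rec (suc n)) (ℕ→ℚ (suc n)) z))

/≡*rec : ∀ i d → i / suc d ≡ (i / 1) * rec (suc d)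
/≡*rec i d = *-cancel-suc d (begin
  ℕ→ℚ (suc d) * (i / suc d)                ≡⟨ *-comm (ℕ→ℚ (suc d)) (i / suc d) ⟩
  (i / suc d) * ℕ→ℚ (suc d)                ≡⟨ /-*-cancel i (suc d) ⟩
  i / 1                                    ≡⟨ *-identityʳ (i / 1) ⟨
  (i / 1) * 1ℚ                             ≡⟨ cong ((i / 1) *_) (rec-inverseˡ d) ⟨
  (i / 1) * (rec (suc d) * ℕ→ℚ (suc d))    ≡⟨ swap (i / 1) (rec (suc d)) (ℕ→ℚ (suc d)) ⟩
  ℕ→ℚ (suc d) * ((i / 1) * rec (suc d))    ∎)
  where
  swap : ∀ a b c → a * (b * c) ≡ c * (a * b)
  swap = solve-∀ ℚ-ring

-- Sums

∑₀-cong : ∀ n {f g : ℕ → ℚ} → (∀ r → r ≤ n → f r ≡ g r) → ∑₀ n f ≡ ∑₀ n g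
∑₀-cong zero    h = h 0 z≤n
∑₀-cong (suc n) h = cong₂ _+_ (∑₀-cong n (λ r r≤n → h r (ℕ.m≤n⇒m≤1+n r≤n))) (h (suc n) ℕ.≤-refl)

∑₀-+ : ∀ n (f g : ℕ → ℚ) → ∑₀ n (λ r → f r + g r) ≡ ∑₀ n f + ∑₀ n g
∑₀-+ zero    f g = refl
∑₀-+ (suc n) f g = trans (cong (_+ (f (suc n) + g (suc n))) (∑₀-+ n f g)) (interchange (∑₀ n f) (∑₀ n g) (f (suc n)) (g (suc n)))
  where
  interchange : ∀ a b c d → (a + b) + (c + d) ≡ (a + c) + (b + d)
  interchange = solve-∀ ℚ-ring

∑₀-*ˡ : ∀ n c (f : ℕ → ℚ) → ∑₀ n (λ r → c * f r) ≡ c * ∑₀ n f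
∑₀-*ˡ zero    c f = refl
∑₀-*ˡ (suc n) c f = trans (cong (_+ c * f (suc n)) (∑₀-*ˡ n c f)) (distrib c (∑₀ n f) (f (suc n)))
  where
  distrib : ∀ c a b → c * a + c * b ≡ c * (a + b)
  distrib = solve-∀ ℚ-ring

∑₀-0 : ∀ n → ∑₀ n (λ _ → 0ℚ) ≡ 0ℚ
∑₀-0 zero    = refl
∑₀-0 (suc n) = cong (_+ 0ℚ) (∑₀-0 n)

∑₀-head : ∀ n (f : ℕ → ℚ) → ∑₀ (suc n) f ≡ f 0 + ∑₀ n (f ∘ suc)
∑₀-head zero    f = refl
∑₀-head (suc n) f = trans (cong (_+ f (suc (suc n))) (∑₀-head n f)) (+-assoc (f 0) (∑₀ n (f ∘ suc)) (f (suc (suc n))))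

∑₁-cong : ∀ n {f g : ℕ → ℚ} → (∀ k → k < n → f (suc k) ≡ g (suc k)) → ∑₁ n f ≡ ∑₁ n g
∑₁-cong zero    h = refl
∑₁-cong (suc n) h = cong₂ _+_ (∑₁-cong n (λ k k<n → h k (ℕ.m<n⇒m<1+n k<n))) (h n ℕ.≤-refl)

∑₁-+ : ∀ n (f g : ℕ → ℚ) → ∑₁ n (λ r → f r + g r) ≡ ∑₁ n f + ∑₁ n g
∑₁-+ zero    f g = refl
∑₁-+ (suc n) f g = trans (cong (_+ (f (suc n) + g (suc n))) (∑₁-+ n f g)) (interchange (∑₁ n f) (∑₁ n g) (f (suc n)) (g (suc n)))
  where
  interchange : ∀ a b c d → (a + b) + (c + d) ≡ (a + c) + (b + d)
  interchange = solve-∀ ℚ-ring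

∑₁-*ˡ : ∀ n c (f : ℕ → ℚ) → ∑₁ n (λ r → c * f r) ≡ c * ∑₁ n f
∑₁-*ˡ zero    c f = sym (*-zeroʳ c)
∑₁-*ˡ (suc n) c f = trans (cong (_+ c * f (suc n)) (∑₁-*ˡ n c f)) (distrib c (∑₁ n f) (f (suc n)))
  where
  distrib : ∀ c a b → c * a + c * b ≡ c * (a + b)
  distrib = solve-∀ ℚ-ring

∑₁-∑₀-comm : ∀ N n (f : ℕ → ℕ → ℚ) → ∑₁ N (λ k → ∑₀ n (f k)) ≡ ∑₀ n (λ r → ∑₁ N (λ k → f k r))
∑₁-∑₀-comm zero    n f = sym (∑₀-0 n)
∑₁-∑₀-comm (suc N) n f = trans (cong (_+ ∑₀ n (f (suc N))) (∑₁-∑₀-comm N n f)) (sym (∑₀-+ n (λ r → ∑₁ N (λ k → f k r)) (f (suc N))))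

-- Exponential generating functions

Seq : Set
Seq = ℕ → ℚ

infixl 7 _⋆_
infixl 6 _⊕_

_⊕_ : Seq → Seq → Seq
(a ⊕ b) n = a n + b n

_·_ : ℚ → Seq → Seq
(c · a) n = c * a n

-- The product of exponential generating functions, by the Leibniz rule: differentiation is the shift a ∘ suc.
_⋆_ : Seq → Seq → Seq
(a ⋆ b) zero    = a 0 * b 0
(a ⋆ b) (suc n) = ((a ∘ suc) ⋆ b) n + (a ⋆ (b ∘ suc)) n

⋆-cong : ∀ {a a′ b b′} → a ≗ a′ → b ≗ b′ → a ⋆ b ≗ a′ ⋆ b′
⋆-cong p q zero    = cong₂ _*_ (p 0) (q 0)
⋆-cong p q (suc n) = cong₂ _+_ (⋆-cong (p ∘ suc) q n) (⋆-cong p (q ∘ suc) n)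

⋆-congˡ : ∀ {a b b′} → b ≗ b′ → a ⋆ b ≗ a ⋆ b′
⋆-congˡ = ⋆-cong (λ _ → refl)

⋆-congʳ : ∀ {a a′ b} → a ≗ a′ → a ⋆ b ≗ a′ ⋆ b
⋆-congʳ p = ⋆-cong p (λ _ → refl)

⋆-comm : ∀ a b → a ⋆ b ≗ b ⋆ a
⋆-comm a b zero    = *-comm (a 0) (b 0)
⋆-comm a b (suc n) = trans (cong₂ _+_ (⋆-comm (a ∘ suc) b n) (⋆-comm a (b ∘ suc) n)) (+-comm ((b ⋆ (a ∘ suc)) n) (((b ∘ suc) ⋆ a) n))

⋆-distribʳ : ∀ c a b → (a ⊕ b) ⋆ c ≗ (a ⋆ c) ⊕ (b ⋆ c)
⋆-distribʳ c a b zero    = distrib (a 0) (b 0) (c 0)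
  where
  distrib : ∀ x y z → (x + y) * z ≡ x * z + y * z
  distrib = solve-∀ ℚ-ring
⋆-distribʳ c a b (suc n) = trans (cong₂ _+_ (⋆-distribʳ c (a ∘ suc) (b ∘ suc) n) (⋆-distribʳ (c ∘ suc) a b n))
  (interchange (((a ∘ suc) ⋆ c) n) (((b ∘ suc) ⋆ c) n) ((a ⋆ (c ∘ suc)) n) ((b ⋆ (c ∘ suc)) n))
  where
  interchange : ∀ a b c d → (a + b) + (c + d) ≡ (a + c) + (b + d)
  interchange = solve-∀ ℚ-ring

⋆-distribˡ : ∀ c a b → c ⋆ (a ⊕ b) ≗ (c ⋆ a) ⊕ (c ⋆ b)
⋆-distribˡ c a b n = trans (⋆-comm c (a ⊕ b) n) (trans (⋆-distribʳ c a b n) (cong₂ _+_ (⋆-comm a c n) (⋆-comm b c n)))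

·-⋆ : ∀ x a b → (x · a) ⋆ b ≗ x · (a ⋆ b)
·-⋆ x a b zero    = *-assoc x (a 0) (b 0)
·-⋆ x a b (suc n) = trans (cong₂ _+_ (·-⋆ x (a ∘ suc) b n) (·-⋆ x a (b ∘ suc) n)) (distrib x (((a ∘ suc) ⋆ b) n) ((a ⋆ (b ∘ suc)) n))
  where
  distrib : ∀ c a b → c * a + c * b ≡ c * (a + b)
  distrib = solve-∀ ℚ-ring

⋆-· : ∀ x a b → a ⋆ (x · b) ≗ x · (a ⋆ b)
⋆-· x a b n = trans (⋆-comm a (x · b) n) (trans (·-⋆ x b a n) (cong (x *_) (⋆-comm b a n)))

⋆-assoc : ∀ a b c → (a ⋆ b) ⋆ c ≗ a ⋆ (b ⋆ c)
⋆-assoc a b c zero    = *-assoc (a 0) (b 0) (c 0)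
⋆-assoc a b c (suc n) = begin
  (((a ∘ suc) ⋆ b ⊕ a ⋆ (b ∘ suc)) ⋆ c) n + ((a ⋆ b) ⋆ (c ∘ suc)) n
    ≡⟨ cong (_+ ((a ⋆ b) ⋆ (c ∘ suc)) n) (⋆-distribʳ c ((a ∘ suc) ⋆ b) (a ⋆ (b ∘ suc)) n) ⟩
  (((a ∘ suc) ⋆ b) ⋆ c) n + ((a ⋆ (b ∘ suc)) ⋆ c) n + ((a ⋆ b) ⋆ (c ∘ suc)) n
    ≡⟨ cong₂ _+_ (cong₂ _+_ (⋆-assoc (a ∘ suc) b c n) (⋆-assoc a (b ∘ suc) c n)) (⋆-assoc a b (c ∘ suc) n) ⟩
  ((a ∘ suc) ⋆ (b ⋆ c)) n + (a ⋆ ((b ∘ suc) ⋆ c)) n + (a ⋆ (b ⋆ (c ∘ suc))) n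
    ≡⟨ +-assoc (((a ∘ suc) ⋆ (b ⋆ c)) n) ((a ⋆ ((b ∘ suc) ⋆ c)) n) ((a ⋆ (b ⋆ (c ∘ suc))) n) ⟩
  ((a ∘ suc) ⋆ (b ⋆ c)) n + ((a ⋆ ((b ∘ suc) ⋆ c)) n + (a ⋆ (b ⋆ (c ∘ suc))) n)
    ≡⟨ +-congˡ (((a ∘ suc) ⋆ (b ⋆ c)) n) (⋆-distribˡ a ((b ∘ suc) ⋆ c) (b ⋆ (c ∘ suc)) n) ⟨
  ((a ∘ suc) ⋆ (b ⋆ c)) n + (a ⋆ ((b ∘ suc) ⋆ c ⊕ b ⋆ (c ∘ suc))) n ∎

0ˢ : Seq
0ˢ _ = 0ℚ

1ˢ : Seq
1ˢ zero    = 1ℚ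
1ˢ (suc _) = 0ℚ

⋆-zeroˡ : ∀ a → 0ˢ ⋆ a ≗ 0ˢ
⋆-zeroˡ a zero    = *-zeroˡ (a 0)
⋆-zeroˡ a (suc n) = cong₂ _+_ (⋆-zeroˡ a n) (⋆-zeroˡ (a ∘ suc) n)

⋆-zeroʳ : ∀ a → a ⋆ 0ˢ ≗ 0ˢ
⋆-zeroʳ a n = trans (⋆-comm a 0ˢ n) (⋆-zeroˡ a n)

⋆-identityˡ : ∀ a → 1ˢ ⋆ a ≗ a
⋆-identityˡ a zero    = *-identityˡ (a 0)
⋆-identityˡ a (suc n) = trans (cong₂ _+_ (⋆-zeroˡ a n) (⋆-identityˡ (a ∘ suc) n)) (+-identityˡ (a (suc n)))

⋆-identityʳ : ∀ a → a ⋆ 1ˢ ≗ a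
⋆-identityʳ a n = trans (⋆-comm a 1ˢ n) (⋆-identityˡ a n)

-- For exponential series this is integration from 0; for ordinary series it is multiplication by t
-- (`conv-X`).
up : Seq → Seq
up a zero    = 0ℚ
up a (suc n) = a n

X : Seq
X = up 1ˢ

X⋆-suc : ∀ a n → (X ⋆ a) (suc n) ≡ ℕ→ℚ (suc n) * a n
X⋆-suc a zero    = trans (+-congˡ (1ℚ * a 0) (*-zeroˡ (a 1))) (+-identityʳ (1ℚ * a 0))
X⋆-suc a (suc n) = begin
  (1ˢ ⋆ a) (suc n) + (X ⋆ (a ∘ suc)) (suc n)       ≡⟨ cong₂ _+_ (⋆-identityˡ a (suc n)) (X⋆-suc (a ∘ suc) n) ⟩
  a (suc n) + ℕ→ℚ (suc n) * a (suc n)              ≡⟨ lemma (a (suc n)) (ℕ→ℚ (suc n)) ⟩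
  (1ℚ + ℕ→ℚ (suc n)) * a (suc n)                   ≡⟨ cong (_* a (suc n)) (ℕ→ℚ-suc (suc n)) ⟨
  ℕ→ℚ (suc (suc n)) * a (suc n)                    ∎
  where
  lemma : ∀ x y → x + y * x ≡ (1ℚ + y) * x
  lemma = solve-∀ ℚ-ring

-- Pascal's rule converts the Leibniz recursion into a binomial sum. This is the bridge between the
-- series calculus and the sums in the definitions.
binomial-∑ : ∀ a b n → (a ⋆ b) n ≡ ∑₀ n (λ r → ℕ→ℚ (n C r) * a r * b (n ∸ r))
binomial-∑ a b zero = cong (_* b 0) (sym (*-identityˡ (a 0)))
binomial-∑ a b (suc n) = sym (begin
  ∑₀ (suc n) (λ r → ℕ→ℚ (suc n C r) * a r * b (suc n ∸ r))
    ≡⟨ ∑₀-head n (λ r → ℕ→ℚ (suc n C r) * a r * b (suc n ∸ r)) ⟩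
  ℕ→ℚ (suc n C 0) * a 0 * b (suc n) + ∑₀ n (λ r → ℕ→ℚ (suc n C suc r) * a (suc r) * b (n ∸ r))
    ≡⟨ +-congˡ (ℕ→ℚ (suc n C 0) * a 0 * b (suc n)) (trans (∑₀-cong n pascal) (∑₀-+ n f (λ r → g (suc r)))) ⟩
  ℕ→ℚ (suc n C 0) * a 0 * b (suc n) + (∑₀ n f + ∑₀ n (g ∘ suc))
    ≡⟨ shuffle (ℕ→ℚ (suc n C 0) * a 0 * b (suc n)) (∑₀ n f) (∑₀ n (g ∘ suc)) ⟩
  ∑₀ n f + (g 0 + ∑₀ n (g ∘ suc))
    ≡⟨ +-congˡ (∑₀ n f) (∑₀-head n g) ⟨
  ∑₀ n f + (∑₀ n g + g (suc n))
    ≡⟨ +-congˡ (∑₀ n f) (trans (+-congˡ (∑₀ n g) last) (+-identityʳ (∑₀ n g))) ⟩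
  ∑₀ n f + ∑₀ n g
    ≡⟨ cong₂ _+_ (sym (binomial-∑ (a ∘ suc) b n)) (trans (∑₀-cong n reindex) (sym (binomial-∑ a (b ∘ suc) n))) ⟩
  ((a ∘ suc) ⋆ b) n + (a ⋆ (b ∘ suc)) n ∎)
  where
  f g : ℕ → ℚ
  f r = ℕ→ℚ (n C r) * a (suc r) * b (n ∸ r)
  g r = ℕ→ℚ (n C r) * a r * b (suc n ∸ r)
  pascal : ∀ r → r ≤ n → ℕ→ℚ (suc n C suc r) * a (suc r) * b (n ∸ r) ≡ f r + g (suc r)
  pascal r _ = trans (cong (λ c → c * a (suc r) * b (n ∸ r)) (trans (cong ℕ→ℚ (sym (nCk+nC[k+1]≡[n+1]C[k+1] n r))) (ℕ→ℚ-+ (n C r) (n C suc r))))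
    (distrib (ℕ→ℚ (n C r)) (ℕ→ℚ (n C suc r)) (a (suc r)) (b (n ∸ r)))
    where
    distrib : ∀ x y z w → (x + y) * z * w ≡ x * z * w + y * z * w
    distrib = solve-∀ ℚ-ring
  shuffle : ∀ x y z → x + (y + z) ≡ y + (x + z)
  shuffle = solve-∀ ℚ-ring
  last : g (suc n) ≡ 0ℚ
  last = trans (cong (λ c → ℕ→ℚ c * a (suc n) * b (n ∸ n)) (k>n⇒nCk≡0 (ℕ.n<1+n n))) (kill (a (suc n)) (b (n ∸ n)))
    where
    kill : ∀ x y → 0ℚ * x * y ≡ 0ℚ
    kill = solve-∀ ℚ-ring
  reindex : ∀ r → r ≤ n → g r ≡ ℕ→ℚ (n C r) * a r * b (suc (n ∸ r))
  reindex r r≤n = cong (λ j → ℕ→ℚ (n C r) * a r * b j) (ℕ.+-∸-assoc 1 r≤n)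

-- Binomial coefficients

[1+k]*[1+n]C[1+k]≡[1+n]*nCk : ∀ n k → suc k ℕ.* (suc n C suc k) ≡ suc n ℕ.* (n C k)
[1+k]*[1+n]C[1+k]≡[1+n]*nCk zero zero = refl
[1+k]*[1+n]C[1+k]≡[1+n]*nCk zero (suc k) = trans (cong (suc (suc k) ℕ.*_) (k>n⇒nCk≡0 {1} {suc (suc k)} (s≤s (s≤s z≤n))))
  (trans (ℕ.*-zeroʳ (suc (suc k))) (sym (trans (ℕ.*-identityˡ (0 C suc k)) (k>n⇒nCk≡0 {0} {suc k} (s≤s z≤n)))))
[1+k]*[1+n]C[1+k]≡[1+n]*nCk (suc n) zero = trans (ℕ.*-identityˡ (suc (suc n) C 1)) (trans (sym (nCk+nC[k+1]≡[n+1]C[k+1] (suc n) 0))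
  (trans (cong (suc n C 0 ℕ.+_) (trans (sym (ℕ.*-identityˡ (suc n C 1))) ([1+k]*[1+n]C[1+k]≡[1+n]*nCk n zero))) refl))
[1+k]*[1+n]C[1+k]≡[1+n]*nCk (suc n) (suc k) = begin
  suc (suc k) ℕ.* (suc (suc n) C suc (suc k))
    ≡⟨ cong (suc (suc k) ℕ.*_) (nCk+nC[k+1]≡[n+1]C[k+1] (suc n) (suc k)) ⟨
  suc (suc k) ℕ.* (c₁ ℕ.+ (suc n C suc (suc k)))
    ≡⟨ expand k c₁ (suc n C suc (suc k)) ⟩
  c₁ ℕ.+ suc k ℕ.* c₁ ℕ.+ suc (suc k) ℕ.* (suc n C suc (suc k))
    ≡⟨ cong₂ (λ x y → c₁ ℕ.+ x ℕ.+ y) ([1+k]*[1+n]C[1+k]≡[1+n]*nCk n k) ([1+k]*[1+n]C[1+k]≡[1+n]*nCk n (suc k)) ⟩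
  c₁ ℕ.+ suc n ℕ.* (n C k) ℕ.+ suc n ℕ.* (n C suc k)
    ≡⟨ collect n c₁ (n C k) (n C suc k) ⟩
  c₁ ℕ.+ suc n ℕ.* ((n C k) ℕ.+ (n C suc k))
    ≡⟨ cong (λ x → c₁ ℕ.+ suc n ℕ.* x) (nCk+nC[k+1]≡[n+1]C[k+1] n k) ⟩
  suc (suc n) ℕ.* c₁ ∎
  where
  c₁ = suc n C suc k
  expand : ∀ k x y → suc (suc k) ℕ.* (x ℕ.+ y) ≡ x ℕ.+ suc k ℕ.* x ℕ.+ suc (suc k) ℕ.* y
  expand = ℕ-solve-∀
  collect : ∀ n x y z → x ℕ.+ suc n ℕ.* y ℕ.+ suc n ℕ.* z ≡ x ℕ.+ suc n ℕ.* (y ℕ.+ z)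
  collect = ℕ-solve-∀

[1+n∸k]*[1+n]Ck≡[1+n]*nCk : ∀ n k → k ≤ n → suc (n ∸ k) ℕ.* (suc n C k) ≡ suc n ℕ.* (n C k)
[1+n∸k]*[1+n]Ck≡[1+n]*nCk n k k≤n = begin
  suc (n ∸ k) ℕ.* (suc n C k)             ≡⟨ cong (suc (n ∸ k) ℕ.*_) (nCk≡nC[n∸k] (ℕ.m≤n⇒m≤1+n k≤n)) ⟩
  suc (n ∸ k) ℕ.* (suc n C (suc n ∸ k))   ≡⟨ cong (λ j → suc (n ∸ k) ℕ.* (suc n C j)) (ℕ.+-∸-assoc 1 k≤n) ⟩
  suc (n ∸ k) ℕ.* (suc n C suc (n ∸ k))   ≡⟨ [1+k]*[1+n]C[1+k]≡[1+n]*nCk n (n ∸ k) ⟩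
  suc n ℕ.* (n C (n ∸ k))                 ≡⟨ cong (suc n ℕ.*_) (nCk≡nC[n∸k] k≤n) ⟨
  suc n ℕ.* (n C k)                       ∎

[1+n]Cn≡1+n : ∀ n → suc n C n ≡ suc n
[1+n]Cn≡1+n n = begin
  suc n C n                    ≡⟨ ℕ.*-identityˡ (suc n C n) ⟨
  1 ℕ.* (suc n C n)            ≡⟨ cong (λ j → suc j ℕ.* (suc n C n)) (ℕ.n∸n≡0 n) ⟨
  suc (n ∸ n) ℕ.* (suc n C n)  ≡⟨ [1+n∸k]*[1+n]Ck≡[1+n]*nCk n n ℕ.≤-refl ⟩
  suc n ℕ.* (n C n)            ≡⟨ cong (suc n ℕ.*_) (nCn≡1 n) ⟩
  suc n ℕ.* 1                  ≡⟨ ℕ.*-identityʳ (suc n) ⟩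
  suc n                        ∎

-- Bernoulli numbers

-- The definition of B goes through private functions; the metas recover them by unification.
mutual
  weighted′ : ℕ → ℕ → List ℚ → ℚ
  weighted′ = _

  next : List ℚ → ℚ
  next = _

  total : List ℚ → ℚ
  total = _

  last : List ℚ → ℚ
  last = _

  bernList-suc : ∀ n → bernList (suc (suc n)) ≡ bernList (suc n) ++ [ next (bernList (suc n)) ]
  -- Unification solves a meta only when it is applied to distinct variables, so each `with` in this
  -- block abstracts compound arguments.
  bernList-suc n with bernList (suc n)
  ... | l = refl

  next-total : ∀ l → next l ≡ - (((+ 1) / suc (length l)) * total l)
  next-total l = refl

  total-weighted′ : ∀ l → total l ≡ weighted′ (suc (length l)) 0 l
  total-weighted′ l with 0 | suc (length l)
  ... | k | N = refl

  B-last : ∀ n → B n ≡ last (bernList (suc n))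
  B-last n with bernList (suc n)
  ... | l = refl

last-∷ʳ : ∀ xs y → last (xs ++ [ y ]) ≡ y
last-∷ʳ []           y = refl
last-∷ʳ (x ∷ [])     y = refl
last-∷ʳ (x ∷ z ∷ xs) y = last-∷ʳ (z ∷ xs) y

weighted′-∷ʳ : ∀ N k xs y → weighted′ N k (xs ++ [ y ]) ≡ weighted′ N k xs + ℕ→ℚ (N C (k ℕ.+ length xs)) * y
weighted′-∷ʳ N k [] y rewrite ℕ.+-identityʳ k = +-comm (ℕ→ℚ (N C k) * y) 0ℚ
weighted′-∷ʳ N k (x ∷ xs) y rewrite ℕ.+-suc k (length xs) =
  trans (+-congˡ (ℕ→ℚ (N C k) * x) (weighted′-∷ʳ N (suc k) xs y)) (sym (+-assoc (ℕ→ℚ (N C k) * x) (weighted′ N (suc k) xs) (ℕ→ℚ (N C suc (k ℕ.+ length xs)) * y)))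

length-bernList : ∀ n → length (bernList (suc n)) ≡ suc n
length-bernList zero    = refl
length-bernList (suc n) = trans (cong length (bernList-suc n)) (trans (length-++ (bernList (suc n))) (trans (cong (ℕ._+ 1) (length-bernList n)) (ℕ.+-comm (suc n) 1)))

B-next : ∀ n → B (suc n) ≡ next (bernList (suc n))
B-next n = trans (B-last (suc n)) (trans (cong last (bernList-suc n)) (last-∷ʳ (bernList (suc n)) _))

weighted′-bernList : ∀ N n → weighted′ N 0 (bernList (suc n)) ≡ ∑₀ n (λ r → ℕ→ℚ (N C r) * B r)
weighted′-bernList N zero    = +-identityʳ (ℕ→ℚ (N C 0) * 1ℚ)
weighted′-bernList N (suc n) = begin
  weighted′ N 0 (bernList (suc (suc n)))
    ≡⟨ cong (weighted′ N 0) (bernList-suc n) ⟩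
  weighted′ N 0 (bernList (suc n) ++ [ next (bernList (suc n)) ])
    ≡⟨ weighted′-∷ʳ N 0 (bernList (suc n)) (next (bernList (suc n))) ⟩
  weighted′ N 0 (bernList (suc n)) + ℕ→ℚ (N C length (bernList (suc n))) * next (bernList (suc n))
    ≡⟨ cong₂ _+_ (weighted′-bernList N n) (cong₂ (λ j b → ℕ→ℚ (N C j) * b) (length-bernList n) (sym (B-next n))) ⟩
  ∑₀ n (λ r → ℕ→ℚ (N C r) * B r) + ℕ→ℚ (N C suc n) * B (suc n) ∎

B-suc : ∀ n → B (suc n) ≡ - (rec (suc (suc n)) * ∑₀ n (λ r → ℕ→ℚ (suc (suc n) C r) * B r))
B-suc n = begin
  B (suc n)                                               ≡⟨ B-next n ⟩
  next l                                                  ≡⟨ next-total l ⟩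
  - (rec (suc (length l)) * total l)                      ≡⟨ cong (λ t → - (rec (suc (length l)) * t)) (total-weighted′ l) ⟩
  - (rec (suc (length l)) * weighted′ (suc (length l)) 0 l)
    ≡⟨ cong (λ j → - (rec (suc j) * weighted′ (suc j) 0 l)) (length-bernList n) ⟩
  - (rec (suc (suc n)) * weighted′ (suc (suc n)) 0 l)
    ≡⟨ cong (λ t → - (rec (suc (suc n)) * t)) (weighted′-bernList (suc (suc n)) n) ⟩
  - (rec (suc (suc n)) * ∑₀ n (λ r → ℕ→ℚ (suc (suc n) C r) * B r)) ∎
  where l = bernList (suc n)

B-recurrence : ∀ n → ∑₀ (suc n) (λ r → ℕ→ℚ (suc (suc n) C r) * B r) ≡ 0ℚ
B-recurrence n = begin
  s + ℕ→ℚ (suc (suc n) C suc n) * B (suc n)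
    ≡⟨ cong₂ (λ c b → s + ℕ→ℚ c * b) ([1+n]Cn≡1+n (suc n)) (B-suc n) ⟩
  s + N * - (rec (suc (suc n)) * s)
    ≡⟨ regroup s N (rec (suc (suc n))) ⟩
  s + - ((rec (suc (suc n)) * N) * s)
    ≡⟨ cong (λ x → s + - (x * s)) (rec-inverseˡ (suc n)) ⟩
  s + - (1ℚ * s)
    ≡⟨ cancel s ⟩
  0ℚ ∎
  where
  s = ∑₀ n (λ r → ℕ→ℚ (suc (suc n) C r) * B r)
  N = ℕ→ℚ (suc (suc n))
  regroup : ∀ s n i → s + n * - (i * s) ≡ s + - ((i * n) * s)
  regroup = solve-∀ ℚ-ring
  cancel : ∀ s → s + - (1ℚ * s) ≡ 0ℚ
  cancel = solve-∀ ℚ-ring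

E : Seq
E _ = 1ℚ

-- `E` is eᵗ, so this is B(t) (eᵗ - 1) = t: the recurrence makes every coefficient from degree 2 on
-- vanish, and degree 1 supplies t.
B⋆E : B ⋆ E ≗ B ⊕ X
B⋆E zero          = refl
B⋆E (suc zero)    = refl
B⋆E (suc (suc n)) = begin
  (B ⋆ E) (suc (suc n))
    ≡⟨ binomial-∑ B E (suc (suc n)) ⟩
  ∑₀ (suc (suc n)) (λ r → ℕ→ℚ (suc (suc n) C r) * B r * 1ℚ)
    ≡⟨ ∑₀-cong (suc (suc n)) (λ r _ → *-identityʳ (ℕ→ℚ (suc (suc n) C r) * B r)) ⟩
  ∑₀ (suc n) (λ r → ℕ→ℚ (suc (suc n) C r) * B r) + ℕ→ℚ (suc (suc n) C suc (suc n)) * B (suc (suc n))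
    ≡⟨ cong₂ (λ s c → s + ℕ→ℚ c * B (suc (suc n))) (B-recurrence n) (nCn≡1 (suc (suc n))) ⟩
  0ℚ + 1ℚ * B (suc (suc n))
    ≡⟨ tidy (B (suc (suc n))) ⟩
  B (suc (suc n)) + 0ℚ ∎
  where
  tidy : ∀ x → 0ℚ + 1ℚ * x ≡ x + 0ℚ
  tidy = solve-∀ ℚ-ring

-- The series of B is t/(eᵗ - 1), so multiplying by it cancels eᵗ - 1 up to the factor t.
⋆E-fixed⇒0 : ∀ d → d ⋆ E ≗ d → d ≗ 0ˢ
⋆E-fixed⇒0 d fixed n = *-cancel-suc n (begin
  ℕ→ℚ (suc n) * d n       ≡⟨ X⋆-suc d n ⟨
  (X ⋆ d) (suc n)         ≡⟨ x+y≡x⇒y≡0 ((B ⋆ d) (suc n)) ((X ⋆ d) (suc n)) (begin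
    (B ⋆ d) (suc n) + (X ⋆ d) (suc n)  ≡⟨ ⋆-distribʳ d B X (suc n) ⟨
    ((B ⊕ X) ⋆ d) (suc n)              ≡⟨ ⋆-congʳ B⋆E (suc n) ⟨
    ((B ⋆ E) ⋆ d) (suc n)              ≡⟨ ⋆-assoc B E d (suc n) ⟩
    (B ⋆ (E ⋆ d)) (suc n)              ≡⟨ ⋆-congˡ (λ j → trans (⋆-comm E d j) (fixed j)) (suc n) ⟩
    (B ⋆ d) (suc n)                    ∎) ⟩
  0ℚ                      ≡⟨ *-zeroʳ (ℕ→ℚ (suc n)) ⟨
  ℕ→ℚ (suc n) * 0ℚ        ∎)
  where
  x+y≡x⇒y≡0 : ∀ x y → x + y ≡ x → y ≡ 0ℚ
  x+y≡x⇒y≡0 x y h = trans (l x y) (trans (cong (_- x) h) (r x))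
    where
    l : ∀ x y → y ≡ (x + y) - x
    l = solve-∀ ℚ-ring
    r : ∀ x → x - x ≡ 0ℚ
    r = solve-∀ ℚ-ring

-- Parity

sgn : ℕ → ℚ
sgn zero    = 1ℚ
sgn (suc n) = - sgn n

sgn-even : ∀ n → n % 2 ≡ 0 → sgn n ≡ 1ℚ
sgn-even zero          _ = refl
sgn-even (suc zero)    ()
sgn-even (suc (suc n)) h = cong (λ x → - - x) (sgn-even n h)

sgn-odd : ∀ n → n % 2 ≡ 1 → sgn n ≡ - 1ℚ
sgn-odd zero          ()
sgn-odd (suc zero)    _ = refl
sgn-odd (suc (suc n)) h = cong (λ x → - - x) (sgn-odd n h)

-- Substitution of -t for t.
alt : Seq → Seq
alt a n = sgn n * a n

neg-*ˡ : ∀ x y → - x * y ≡ - 1ℚ * (x * y)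
neg-*ˡ = solve-∀ ℚ-ring

alt-⋆ : ∀ a b → alt a ⋆ alt b ≗ alt (a ⋆ b)
alt-⋆ a b zero    = lemma (a 0) (b 0)
  where
  lemma : ∀ x y → (1ℚ * x) * (1ℚ * y) ≡ 1ℚ * (x * y)
  lemma = solve-∀ ℚ-ring
alt-⋆ a b (suc n) = begin
  ((alt a ∘ suc) ⋆ alt b) n + (alt a ⋆ (alt b ∘ suc)) n
    ≡⟨ cong₂ _+_ (⋆-congʳ (λ j → neg-*ˡ (sgn j) (a (suc j))) n) (⋆-congˡ (λ j → neg-*ˡ (sgn j) (b (suc j))) n) ⟩
  (((- 1ℚ) · alt (a ∘ suc)) ⋆ alt b) n + (alt a ⋆ ((- 1ℚ) · alt (b ∘ suc))) n
    ≡⟨ cong₂ _+_ (trans (·-⋆ (- 1ℚ) (alt (a ∘ suc)) (alt b) n) (cong (- 1ℚ *_) (alt-⋆ (a ∘ suc) b n)))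
                 (trans (⋆-· (- 1ℚ) (alt a) (alt (b ∘ suc)) n) (cong (- 1ℚ *_) (alt-⋆ a (b ∘ suc) n))) ⟩
  - 1ℚ * (sgn n * ((a ∘ suc) ⋆ b) n) + - 1ℚ * (sgn n * (a ⋆ (b ∘ suc)) n)
    ≡⟨ lemma (sgn n) (((a ∘ suc) ⋆ b) n) ((a ⋆ (b ∘ suc)) n) ⟩
  - sgn n * (((a ∘ suc) ⋆ b) n + (a ⋆ (b ∘ suc)) n) ∎
  where
  lemma : ∀ s x y → - 1ℚ * (s * x) + - 1ℚ * (s * y) ≡ - s * (x + y)
  lemma = solve-∀ ℚ-ring

altE⋆E : alt E ⋆ E ≗ 1ˢ
altE⋆E zero    = refl
altE⋆E (suc n) = begin
  ((alt E ∘ suc) ⋆ E) n + (alt E ⋆ E) n        ≡⟨ cong (_+ (alt E ⋆ E) n) (trans (⋆-congʳ (λ j → neg-*ˡ (sgn j) 1ℚ) n) (·-⋆ (- 1ℚ) (alt E) E n)) ⟩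
  - 1ℚ * (alt E ⋆ E) n + (alt E ⋆ E) n         ≡⟨ lemma ((alt E ⋆ E) n) ⟩
  0ℚ                                           ∎
  where
  lemma : ∀ x → - 1ℚ * x + x ≡ 0ℚ
  lemma = solve-∀ ℚ-ring

alt-X : ∀ n → sgn n * X n ≡ - X n
alt-X zero          = refl
alt-X (suc zero)    = refl
alt-X (suc (suc n)) = *-zeroʳ (sgn (suc (suc n)))

-- B(-t) and B(t) eᵗ both solve f(t) (eᵗ - 1) = t eᵗ.
alt-B : ∀ n → sgn n * B n ≡ B n + X n
alt-B n = x-y≡0⇒x≡y (alt B n) ((B ⊕ X) n) (⋆E-fixed⇒0 (alt B ⊕ ((- 1ℚ) · (B ⊕ X))) fixed n)
  where
  x-y≡0⇒x≡y : ∀ x y → x + - 1ℚ * y ≡ 0ℚ → x ≡ y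
  x-y≡0⇒x≡y x y h = trans (l x y) (trans (cong (_+ y) h) (+-identityˡ y))
    where
    l : ∀ x y → x ≡ (x + - 1ℚ * y) + y
    l = solve-∀ ℚ-ring

  -- Replacing t by -t in `B⋆E` gives B(-t) e^(-t) = B(-t) - t; multiplication by eᵗ then gives the
  -- claim.
  altB⋆E : ∀ n → (alt B ⋆ E) n ≡ alt B n + (X ⋆ E) n
  altB⋆E n = begin
    (alt B ⋆ E) n                                   ≡⟨ split ((alt B ⋆ E) n) ((X ⋆ E) n) ⟩
    ((alt B ⋆ E) n + - 1ℚ * (X ⋆ E) n) + (X ⋆ E) n  ≡⟨ cong (_+ (X ⋆ E) n) (begin
      (alt B ⋆ E) n + - 1ℚ * (X ⋆ E) n              ≡⟨ +-congˡ ((alt B ⋆ E) n) (·-⋆ (- 1ℚ) X E n) ⟨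
      (alt B ⋆ E) n + (((- 1ℚ) · X) ⋆ E) n          ≡⟨ ⋆-distribʳ E (alt B) ((- 1ℚ) · X) n ⟨
      ((alt B ⊕ (- 1ℚ) · X) ⋆ E) n                  ≡⟨ ⋆-congʳ altB⋆altE n ⟨
      ((alt B ⋆ alt E) ⋆ E) n                       ≡⟨ ⋆-assoc (alt B) (alt E) E n ⟩
      (alt B ⋆ (alt E ⋆ E)) n                       ≡⟨ ⋆-congˡ altE⋆E n ⟩
      (alt B ⋆ 1ˢ) n                                ≡⟨ ⋆-identityʳ (alt B) n ⟩
      alt B n                                       ∎) ⟩
    alt B n + (X ⋆ E) n ∎
    where
    split : ∀ x y → x ≡ (x + - 1ℚ * y) + y
    split = solve-∀ ℚ-ring
    distrib : ∀ s b x → s * (b + x) ≡ s * b + s * x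
    distrib = solve-∀ ℚ-ring
    neg : ∀ x → - x ≡ - 1ℚ * x
    neg = solve-∀ ℚ-ring
    altB⋆altE : alt B ⋆ alt E ≗ alt B ⊕ (- 1ℚ) · X
    altB⋆altE j = trans (alt-⋆ B E j) (trans (cong (sgn j *_) (B⋆E j)) (trans (distrib (sgn j) (B j) (X j)) (+-congˡ (alt B j) (trans (alt-X j) (neg (X j))))))

  fixed : (alt B ⊕ ((- 1ℚ) · (B ⊕ X))) ⋆ E ≗ alt B ⊕ ((- 1ℚ) · (B ⊕ X))
  fixed n = begin
    ((alt B ⊕ ((- 1ℚ) · (B ⊕ X))) ⋆ E) n             ≡⟨ ⋆-distribʳ E (alt B) ((- 1ℚ) · (B ⊕ X)) n ⟩
    (alt B ⋆ E) n + (((- 1ℚ) · (B ⊕ X)) ⋆ E) n       ≡⟨ cong₂ _+_ (altB⋆E n) (·-⋆ (- 1ℚ) (B ⊕ X) E n) ⟩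
    (alt B n + (X ⋆ E) n) + - 1ℚ * ((B ⊕ X) ⋆ E) n   ≡⟨ cong (λ x → (alt B n + (X ⋆ E) n) + - 1ℚ * x) (trans (⋆-distribʳ E B X n) (cong (_+ (X ⋆ E) n) (B⋆E n))) ⟩
    (alt B n + (X ⋆ E) n) + - 1ℚ * ((B n + X n) + (X ⋆ E) n) ≡⟨ lemma (alt B n) ((X ⋆ E) n) (B n + X n) ⟩
    alt B n + - 1ℚ * (B n + X n) ∎
    where
    lemma : ∀ a x b → (a + x) + - 1ℚ * (b + x) ≡ a + - 1ℚ * b
    lemma = solve-∀ ℚ-ring

x≡-1*x⇒x≡0 : ∀ x → x ≡ - 1ℚ * x → x ≡ 0ℚ
x≡-1*x⇒x≡0 x h = trans (l x) (trans (cong (λ y → ½ * (x + - 1ℚ * y)) (sym h)) (r x))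
  where
  l : ∀ x → x ≡ ½ * (x + - 1ℚ * (- 1ℚ * x))
  l = solve-∀ ℚ-ring
  r : ∀ x → ½ * (x + - 1ℚ * x) ≡ 0ℚ
  r = solve-∀ ℚ-ring

neg-involutive : ∀ x → x ≡ - - x
neg-involutive = solve-∀ ℚ-ring

-- B minus its only odd-indexed nonzero term B 1 = -½.
ε : Seq
ε n = B n + ½ * X n

-- By `alt-B`, replacing t by -t exchanges B(t) and B(t) + t, and ε is their mean.
alt-ε : ∀ n → sgn n * ε n ≡ ε n
alt-ε n = trans (distrib (sgn n) (B n) (X n)) (trans (cong₂ (λ b x → b + ½ * x) (alt-B n) (alt-X n)) (collect (B n) (X n)))
  where
  distrib : ∀ s b x → s * (b + ½ * x) ≡ s * b + ½ * (s * x)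
  distrib = solve-∀ ℚ-ring
  collect : ∀ b x → b + x + ½ * - x ≡ b + ½ * x
  collect = solve-∀ ℚ-ring

B≡ε : B ≗ ε ⊕ (- ½) · X
B≡ε n = lemma (B n) (X n)
  where
  lemma : ∀ b x → b ≡ b + ½ * x + - ½ * x
  lemma = solve-∀ ℚ-ring

ε-odd : ∀ n → sgn n ≡ - 1ℚ → ε n ≡ 0ℚ
ε-odd n h = x≡-1*x⇒x≡0 (ε n) (trans (sym (alt-ε n)) (cong (_* ε n) h))

X-even : ∀ n → sgn n ≡ 1ℚ → X n ≡ 0ℚ
X-even zero          h = refl
X-even (suc zero)    ()
X-even (suc (suc n)) h = refl

ε-even : ∀ n → sgn n ≡ 1ℚ → ε n ≡ B n
ε-even n h = trans (cong (λ x → B n + ½ * x) (X-even n h)) (+-identityʳ (B n))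

B-odd : ∀ n → sgn n ≡ - 1ℚ → n ≢ 1 → B n ≡ 0ℚ
B-odd zero          () _
B-odd (suc zero)    h n≢1 = ⊥-elim (n≢1 refl)
B-odd (suc (suc n)) h _ = trans (B≡ε (suc (suc n))) (trans (+-identityʳ (ε (suc (suc n)))) (ε-odd (suc (suc n)) h))

-- Ordinary generating functions

conv : Seq → Seq → Seq
conv a b n = ∑₀ n (λ r → a r * b (n ∸ r))

conv-suc : ∀ a b n → conv a b (suc n) ≡ a 0 * b (suc n) + conv (a ∘ suc) b n
conv-suc a b n = ∑₀-head n (λ r → a r * b (suc n ∸ r))

conv-cong : ∀ {a a′ b b′} → a ≗ a′ → b ≗ b′ → conv a b ≗ conv a′ b′
conv-cong p q n = ∑₀-cong n (λ r _ → cong₂ _*_ (p r) (q (n ∸ r)))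

conv-distribʳ : ∀ c a b → conv (a ⊕ b) c ≗ conv a c ⊕ conv b c
conv-distribʳ c a b n = trans (∑₀-cong n (λ r _ → distrib (a r) (b r) (c (n ∸ r)))) (∑₀-+ n (λ r → a r * c (n ∸ r)) (λ r → b r * c (n ∸ r)))
  where
  distrib : ∀ x y z → (x + y) * z ≡ x * z + y * z
  distrib = solve-∀ ℚ-ring

∑₀-reverse : ∀ n (f : ℕ → ℚ) → ∑₀ n f ≡ ∑₀ n (λ r → f (n ∸ r))
∑₀-reverse zero    f = refl
∑₀-reverse (suc n) f = begin
  ∑₀ n f + f (suc n)                       ≡⟨ +-comm (∑₀ n f) (f (suc n)) ⟩
  f (suc n) + ∑₀ n f                       ≡⟨ +-congˡ (f (suc n)) (∑₀-reverse n f) ⟩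
  f (suc n) + ∑₀ n (λ r → f (n ∸ r))       ≡⟨ ∑₀-head n (λ r → f (suc n ∸ r)) ⟨
  ∑₀ (suc n) (λ r → f (suc n ∸ r))         ∎

conv-comm : ∀ a b → conv a b ≗ conv b a
conv-comm a b n = trans (∑₀-reverse n (λ r → a r * b (n ∸ r)))
  (∑₀-cong n (λ r r≤n → trans (cong (λ j → a (n ∸ r) * b j) (ℕ.m∸[m∸n]≡n r≤n)) (*-comm (a (n ∸ r)) (b r))))

conv-distribˡ : ∀ c a b → conv c (a ⊕ b) ≗ conv c a ⊕ conv c b
conv-distribˡ c a b n = trans (conv-comm c (a ⊕ b) n) (trans (conv-distribʳ c a b n) (cong₂ _+_ (conv-comm a c n) (conv-comm b c n)))

conv-zeroˡ : ∀ b → conv 0ˢ b ≗ 0ˢ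
conv-zeroˡ b n = trans (∑₀-cong n (λ r _ → *-zeroˡ (b (n ∸ r)))) (∑₀-0 n)

conv-identityˡ : ∀ b → conv 1ˢ b ≗ b
conv-identityˡ b zero    = *-identityˡ (b 0)
conv-identityˡ b (suc n) = trans (conv-suc 1ˢ b n) (trans (cong₂ _+_ (*-identityˡ (b (suc n))) (conv-zeroˡ b n)) (+-identityʳ (b (suc n))))

conv-X : ∀ b → conv X b ≗ up b
conv-X b zero    = *-zeroˡ (b 0)
conv-X b (suc n) = trans (conv-suc X b n) (trans (cong₂ _+_ (*-zeroˡ (b (suc n))) (conv-identityˡ b n)) (+-identityˡ (b n)))

-- Summed over all k, the products of the binomial transforms use ∑ₖ C(k,i) C(n-k,j) = C(n+1,i+j+1).
up-conv-⋆E : ∀ n a b → (up (conv a b) ⋆ E) (suc n) ≡ conv (a ⋆ E) (b ⋆ E) n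
up-conv-⋆E zero    a b = lemma (a 0) (b 0)
  where
  lemma : ∀ x y → x * y * 1ℚ + 0ℚ * 1ℚ ≡ x * 1ℚ * (y * 1ℚ)
  lemma = solve-∀ ℚ-ring
up-conv-⋆E (suc n) a b = begin
  (conv a b ⋆ E) (suc n) + (up (conv a b) ⋆ E) (suc n)
    ≡⟨ cong₂ _+_ (⋆-congʳ split (suc n)) (up-conv-⋆E n a b) ⟩
  ((a 0 · b ⊕ up (conv (a ∘ suc) b)) ⋆ E) (suc n) + conv (a ⋆ E) (b ⋆ E) n
    ≡⟨ cong (_+ conv (a ⋆ E) (b ⋆ E) n) (trans (⋆-distribʳ E (a 0 · b) (up (conv (a ∘ suc) b)) (suc n)) (cong₂ _+_ (·-⋆ (a 0) b E (suc n)) (up-conv-⋆E n (a ∘ suc) b))) ⟩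
  a 0 * (b ⋆ E) (suc n) + conv ((a ∘ suc) ⋆ E) (b ⋆ E) n + conv (a ⋆ E) (b ⋆ E) n
    ≡⟨ lemma (a 0) ((b ⋆ E) (suc n)) (conv ((a ∘ suc) ⋆ E) (b ⋆ E) n) (conv (a ⋆ E) (b ⋆ E) n) ⟩
  a 0 * 1ℚ * (b ⋆ E) (suc n) + (conv ((a ∘ suc) ⋆ E) (b ⋆ E) n + conv (a ⋆ E) (b ⋆ E) n)
    ≡⟨ +-congˡ (a 0 * 1ℚ * (b ⋆ E) (suc n)) (conv-distribʳ (b ⋆ E) ((a ∘ suc) ⋆ E) (a ⋆ E) n) ⟨
  a 0 * 1ℚ * (b ⋆ E) (suc n) + conv ((a ⋆ E) ∘ suc) (b ⋆ E) n
    ≡⟨ conv-suc (a ⋆ E) (b ⋆ E) n ⟨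
  conv (a ⋆ E) (b ⋆ E) (suc n) ∎
  where
  split : conv a b ≗ a 0 · b ⊕ up (conv (a ∘ suc) b)
  split zero    = sym (+-identityʳ (a 0 * b 0))
  split (suc j) = conv-suc a b j
  lemma : ∀ x y z w → x * y + z + w ≡ x * 1ℚ * y + (z + w)
  lemma = solve-∀ ℚ-ring

Q : Seq
Q = conv B B

-- `up-conv-⋆E` carries eᵗ into both factors, so for ordinary series this is (B + t)² = B² + 2tB +
-- t². Multiplying it by the exponential series B(t) produces `convolution-identity`.
upQ⋆E : up Q ⋆ E ≗ up Q ⊕ ((+ 2 / 1) · up (up B) ⊕ up (up X))
upQ⋆E zero    = refl
upQ⋆E (suc n) = begin
  (up Q ⋆ E) (suc n)                                   ≡⟨ up-conv-⋆E n B B ⟩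
  conv (B ⋆ E) (B ⋆ E) n                               ≡⟨ conv-cong B⋆E B⋆E n ⟩
  conv (B ⊕ X) (B ⊕ X) n                               ≡⟨ conv-distribʳ (B ⊕ X) B X n ⟩
  conv B (B ⊕ X) n + conv X (B ⊕ X) n                  ≡⟨ cong₂ _+_ (conv-distribˡ B B X n) (conv-X (B ⊕ X) n) ⟩
  Q n + conv B X n + up (B ⊕ X) n                      ≡⟨ cong₂ (λ x y → Q n + x + y) (trans (conv-comm B X n) (conv-X B n)) (up-⊕ n) ⟩
  Q n + up B n + (up B n + up X n)                     ≡⟨ lemma (Q n) (up B n) (up X n) ⟩
  Q n + ((+ 2 / 1) * up B n + up X n)                  ∎
  where
  up-⊕ : up (B ⊕ X) ≗ up B ⊕ up X
  up-⊕ zero    = refl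
  up-⊕ (suc j) = refl
  lemma : ∀ q b x → q + b + (b + x) ≡ q + ((+ 2 / 1) * b + x)
  lemma = solve-∀ ℚ-ring

-- Matiyasevich's identity, up to a correction term that is a multiple of B (n - 1).
convolution-identity : ∀ n → ℕ→ℚ (suc (suc n)) * Q n ≡ (+ 2 / 1) * (B ⋆ up (up B)) (suc (suc n)) + (B ⋆ up (up X)) (suc (suc n))
convolution-identity n = x+y≡x+z⇒y≡z ((B ⋆ up Q) N) (begin
  (B ⋆ up Q) N + ℕ→ℚ (suc (suc n)) * Q n               ≡⟨ +-congˡ ((B ⋆ up Q) N) (X⋆-suc (up Q) (suc n)) ⟨
  (B ⋆ up Q) N + (X ⋆ up Q) N                          ≡⟨ ⋆-distribʳ (up Q) B X N ⟨
  ((B ⊕ X) ⋆ up Q) N                                   ≡⟨ ⋆-congʳ B⋆E N ⟨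
  ((B ⋆ E) ⋆ up Q) N                                   ≡⟨ ⋆-assoc B E (up Q) N ⟩
  (B ⋆ (E ⋆ up Q)) N                                   ≡⟨ ⋆-congˡ (λ j → trans (⋆-comm E (up Q) j) (upQ⋆E j)) N ⟩
  (B ⋆ (up Q ⊕ ((+ 2 / 1) · up (up B) ⊕ up (up X)))) N ≡⟨ ⋆-distribˡ B (up Q) ((+ 2 / 1) · up (up B) ⊕ up (up X)) N ⟩
  (B ⋆ up Q) N + (B ⋆ ((+ 2 / 1) · up (up B) ⊕ up (up X))) N
    ≡⟨ +-congˡ ((B ⋆ up Q) N) (trans (⋆-distribˡ B ((+ 2 / 1) · up (up B)) (up (up X)) N) (cong (_+ (B ⋆ up (up X)) N) (⋆-· (+ 2 / 1) B (up (up B)) N))) ⟩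
  (B ⋆ up Q) N + ((+ 2 / 1) * (B ⋆ up (up B)) N + (B ⋆ up (up X)) N) ∎)
  where
  N = suc (suc n)
  x+y≡x+z⇒y≡z : ∀ x {y z} → x + y ≡ x + z → y ≡ z
  x+y≡x+z⇒y≡z x {y} {z} h = trans (l x y) (trans (cong (_- x) h) (sym (l x z)))
    where
    l : ∀ x y → y ≡ (x + y) - x
    l = solve-∀ ℚ-ring

2ℚ 3ℚ 4ℚ 12ℚ : ℚ
2ℚ = + 2 / 1
3ℚ = + 3 / 1
4ℚ = + 4 / 1
12ℚ = + 12 / 1

-- Products with powers of X

X⋆≡ : ∀ a n → (X ⋆ a) n ≡ ℕ→ℚ n * up a n
X⋆≡ a zero    = trans (*-zeroˡ (a 0)) (sym (*-zeroˡ 0ℚ))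
X⋆≡ a (suc n) = X⋆-suc a n

-- As exponential series `up X` is t²/2 and `up (up X)` is t³/6. Expressing them through X reduces
-- their products to repeated use of `X⋆-suc`, at the price of the factors 2 and 3.
2·upX≡X⋆X : 2ℚ · up X ≗ X ⋆ X
2·upX≡X⋆X zero                = refl
2·upX≡X⋆X (suc zero)          = refl
2·upX≡X⋆X (suc (suc zero))    = refl
2·upX≡X⋆X (suc (suc (suc n))) = trans (*-zeroʳ 2ℚ) (sym (trans (X⋆-suc X (suc (suc n))) (*-zeroʳ (ℕ→ℚ (suc (suc (suc n)))))))

3·upupX≡X⋆upX : 3ℚ · up (up X) ≗ X ⋆ up X
3·upupX≡X⋆upX zero                      = refl
3·upupX≡X⋆upX (suc zero)                = refl
3·upupX≡X⋆upX (suc (suc zero))          = refl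
3·upupX≡X⋆upX (suc (suc (suc zero)))    = refl
3·upupX≡X⋆upX (suc (suc (suc (suc n)))) = trans (*-zeroʳ 3ℚ) (sym (trans (X⋆-suc (up X) (suc (suc (suc n)))) (*-zeroʳ (ℕ→ℚ (suc (suc (suc (suc n))))))))

upX⋆-suc : ∀ a n → 2ℚ * (up X ⋆ a) (suc n) ≡ ℕ→ℚ (suc n) * (X ⋆ a) n
upX⋆-suc a n = begin
  2ℚ * (up X ⋆ a) (suc n)      ≡⟨ ·-⋆ 2ℚ (up X) a (suc n) ⟨
  ((2ℚ · up X) ⋆ a) (suc n)    ≡⟨ ⋆-congʳ 2·upX≡X⋆X (suc n) ⟩
  ((X ⋆ X) ⋆ a) (suc n)        ≡⟨ ⋆-assoc X X a (suc n) ⟩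
  (X ⋆ (X ⋆ a)) (suc n)        ≡⟨ X⋆-suc (X ⋆ a) n ⟩
  ℕ→ℚ (suc n) * (X ⋆ a) n      ∎

upupX⋆-suc : ∀ a n → 3ℚ * (up (up X) ⋆ a) (suc n) ≡ ℕ→ℚ (suc n) * (up X ⋆ a) n
upupX⋆-suc a n = begin
  3ℚ * (up (up X) ⋆ a) (suc n)    ≡⟨ ·-⋆ 3ℚ (up (up X)) a (suc n) ⟨
  ((3ℚ · up (up X)) ⋆ a) (suc n)  ≡⟨ ⋆-congʳ 3·upupX≡X⋆upX (suc n) ⟩
  ((X ⋆ up X) ⋆ a) (suc n)        ≡⟨ ⋆-assoc X (up X) a (suc n) ⟩
  (X ⋆ (up X ⋆ a)) (suc n)        ≡⟨ X⋆-suc (up X ⋆ a) n ⟩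
  ℕ→ℚ (suc n) * (up X ⋆ a) n      ∎

∑₀-up : ∀ n (f : ℕ → ℚ) b → ∑₀ (suc n) (λ r → f r * up b (suc n ∸ r)) ≡ ∑₀ n (λ r → f r * b (n ∸ r))
∑₀-up n f b = begin
  ∑₀ n (λ r → f r * up b (suc n ∸ r)) + f (suc n) * up b (n ∸ n)
    ≡⟨ cong₂ _+_ (∑₀-cong n (λ r r≤n → cong (λ j → f r * up b j) (ℕ.+-∸-assoc 1 r≤n)))
                 (trans (cong (λ j → f (suc n) * up b j) (ℕ.n∸n≡0 n)) (*-zeroʳ (f (suc n)))) ⟩
  ∑₀ n (λ r → f r * b (n ∸ r)) + 0ℚ
    ≡⟨ +-identityʳ (∑₀ n (λ r → f r * b (n ∸ r))) ⟩
  ∑₀ n (λ r → f r * b (n ∸ r)) ∎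

⋆-up-suc : ∀ a b n → (a ⋆ up b) (suc n) ≡ ∑₀ n (λ r → ℕ→ℚ (suc n C r) * a r * b (n ∸ r))
⋆-up-suc a b n = trans (binomial-∑ a (up b) (suc n)) (∑₀-up n (λ r → ℕ→ℚ (suc n C r) * a r) b)

-- Evaluation of S and D by parity

S≡⋆ : ∀ n → S n ≡ (B ⋆ up B) (suc n)
S≡⋆ n = sym (⋆-up-suc B B n)

-- By `D≡∑` this is the sum over r < n of C(n+1,r) B_r B_{n-1-r}, for n > 0. It accompanies L_n in
-- the coefficient of p, and twice it is the right side of Matiyasevich's identity at n - 1.
D : ℕ → ℚ
D n = (B ⋆ up (up B)) (suc n)

D≡∑ : ∀ n → D (suc n) ≡ ∑₀ n (λ r → ℕ→ℚ (suc (suc n) C r) * B r * B (n ∸ r))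
D≡∑ n = trans (⋆-up-suc B (up B) (suc n)) (∑₀-up n (λ r → ℕ→ℚ (suc (suc n) C r) * B r) B)

even⋆even : ∀ {a b} n → alt a ≗ a → alt b ≗ b → sgn n ≡ - 1ℚ → (a ⋆ b) n ≡ 0ℚ
even⋆even {a} {b} n p q h = x≡-1*x⇒x≡0 ((a ⋆ b) n) (begin
  (a ⋆ b) n                ≡⟨ ⋆-cong p q n ⟨
  (alt a ⋆ alt b) n        ≡⟨ alt-⋆ a b n ⟩
  sgn n * (a ⋆ b) n        ≡⟨ cong (_* (a ⋆ b) n) h ⟩
  - 1ℚ * (a ⋆ b) n         ∎)

even⋆odd : ∀ {a b} n → alt a ≗ a → alt b ≗ (- 1ℚ) · b → sgn n ≡ 1ℚ → (a ⋆ b) n ≡ 0ℚ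
even⋆odd {a} {b} n p q h = x≡-1*x⇒x≡0 ((a ⋆ b) n) (begin
  (a ⋆ b) n                       ≡⟨ *-identityˡ ((a ⋆ b) n) ⟨
  1ℚ * (a ⋆ b) n                  ≡⟨ cong (_* (a ⋆ b) n) h ⟨
  sgn n * (a ⋆ b) n               ≡⟨ alt-⋆ a b n ⟨
  (alt a ⋆ alt b) n               ≡⟨ ⋆-cong p q n ⟩
  (a ⋆ ((- 1ℚ) · b)) n            ≡⟨ ⋆-· (- 1ℚ) a b n ⟩
  - 1ℚ * (a ⋆ b) n                ∎)

alt-upε : alt (up ε) ≗ (- 1ℚ) · up ε
alt-upε zero    = refl
alt-upε (suc n) = trans (neg-*ˡ (sgn n) (ε n)) (cong (- 1ℚ *_) (alt-ε n))

alt-upupε : alt (up (up ε)) ≗ up (up ε)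
alt-upupε zero    = refl
alt-upupε (suc n) = trans (neg-*ˡ (sgn n) (up ε n)) (trans (cong (- 1ℚ *_) (alt-upε n)) (lemma (up ε n)))
  where
  lemma : ∀ x → - 1ℚ * (- 1ℚ * x) ≡ x
  lemma = solve-∀ ℚ-ring

⋆-bilinear : ∀ a b x c d y n → ((a ⊕ x · b) ⋆ (c ⊕ y · d)) n ≡ (a ⋆ c) n + y * (a ⋆ d) n + x * ((b ⋆ c) n + y * (b ⋆ d) n)
⋆-bilinear a b x c d y n = begin
  ((a ⊕ x · b) ⋆ (c ⊕ y · d)) n                                ≡⟨ ⋆-distribʳ (c ⊕ y · d) a (x · b) n ⟩
  (a ⋆ (c ⊕ y · d)) n + ((x · b) ⋆ (c ⊕ y · d)) n              ≡⟨ cong₂ _+_ (right a) (trans (·-⋆ x b (c ⊕ y · d) n) (cong (x *_) (right b))) ⟩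
  (a ⋆ c) n + y * (a ⋆ d) n + x * ((b ⋆ c) n + y * (b ⋆ d) n)  ∎
  where
  right : ∀ e → (e ⋆ (c ⊕ y · d)) n ≡ (e ⋆ c) n + y * (e ⋆ d) n
  right e = trans (⋆-distribˡ e c (y · d) n) (+-congˡ ((e ⋆ c) n) (⋆-· y e d n))

up-linear : ∀ {a b c} x → a ≗ b ⊕ x · c → up a ≗ up b ⊕ x · up c
up-linear x p zero    = sym (trans (+-identityˡ (x * 0ℚ)) (*-zeroʳ x))
up-linear x p (suc n) = p n

-- Split B = ε - t/2 in B ∫B and take the even index n + 2. The product ε ∫ε is odd and t · t²/2
-- lives in degree 3, so only the two cross terms remain, both multiples of B n. The 4 clears the ½
-- of the splitting and that of t²/2.
S-odd : ∀ n → sgn n ≡ 1ℚ → 4ℚ * S (suc n) ≡ - (ℕ→ℚ (suc (suc n)) * ℕ→ℚ (suc (suc (suc n)))) * B n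
S-odd n h = begin
  4ℚ * S (suc n)
    ≡⟨ cong (4ℚ *_) (trans (S≡⋆ (suc n)) (trans (⋆-cong B≡ε (up-linear (- ½) B≡ε) N) (⋆-bilinear ε X (- ½) (up ε) (up X) (- ½) N))) ⟩
  4ℚ * ((ε ⋆ up ε) N + - ½ * (ε ⋆ up X) N + - ½ * ((X ⋆ up ε) N + - ½ * (X ⋆ up X) N))
    ≡⟨ cong₂ (λ x y → 4ℚ * (x + - ½ * (ε ⋆ up X) N + - ½ * ((X ⋆ up ε) N + - ½ * y))) (even⋆odd N alt-ε alt-upε (cong (λ x → - - x) h))
         (trans (X⋆-suc (up X) (suc n)) (trans (cong (ℕ→ℚ N *_) (X-even n h)) (*-zeroʳ (ℕ→ℚ N)))) ⟩
  4ℚ * (0ℚ + - ½ * (ε ⋆ up X) N + - ½ * ((X ⋆ up ε) N + - ½ * 0ℚ))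
    ≡⟨ regroup ((ε ⋆ up X) N) ((X ⋆ up ε) N) ⟩
  - 1ℚ * (2ℚ * (ε ⋆ up X) N) + - 2ℚ * (X ⋆ up ε) N
    ≡⟨ cong₂ (λ x y → - 1ℚ * x + - 2ℚ * y)
         (trans (cong (2ℚ *_) (⋆-comm ε (up X) N)) (trans (upX⋆-suc ε (suc n)) (cong (ℕ→ℚ N *_) (trans (X⋆-suc ε n) (cong (ℕ→ℚ (suc n) *_) (ε-even n h))))))
         (trans (X⋆-suc (up ε) (suc n)) (cong (ℕ→ℚ N *_) (ε-even n h))) ⟩
  - 1ℚ * (ℕ→ℚ N * (ℕ→ℚ (suc n) * B n)) + - 2ℚ * (ℕ→ℚ N * B n)
    ≡⟨ collect (ℕ→ℚ N) (ℕ→ℚ (suc n)) (B n) ⟩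
  - (ℕ→ℚ N * (2ℚ + ℕ→ℚ (suc n))) * B n
    ≡⟨ cong (λ x → - (ℕ→ℚ N * x) * B n) (ℕ→ℚ-+ 2 (suc n)) ⟨
  - (ℕ→ℚ N * ℕ→ℚ (suc (suc (suc n)))) * B n ∎
  where
  N = suc (suc n)
  regroup : ∀ x y → 4ℚ * (0ℚ + - ½ * x + - ½ * (y + - ½ * 0ℚ)) ≡ - 1ℚ * (2ℚ * x) + - 2ℚ * y
  regroup = solve-∀ ℚ-ring
  collect : ∀ N n b → - 1ℚ * (N * (n * b)) + - 2ℚ * (N * b) ≡ - (N * (2ℚ + n)) * b
  collect = solve-∀ ℚ-ring

-- The same splitting with one more integration, at the odd index n + 3: ε ∬ε is even and t · t³/6
-- lives in degree 4, so again the cross terms remain. The 12 is 2 · 6, from the splitting and from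
-- t³/6.
D-even : ∀ n → sgn n ≡ 1ℚ →
  12ℚ * D (suc (suc n)) ≡ - ℕ→ℚ (suc (suc (suc n))) * ((ℕ→ℚ (suc (suc n)) * ℕ→ℚ (suc n) + + 6 / 1) * B n)
D-even n h = begin
  12ℚ * D (suc (suc n))
    ≡⟨ cong (12ℚ *_) (trans (⋆-cong B≡ε (up-linear (- ½) (up-linear (- ½) B≡ε)) N) (⋆-bilinear ε X (- ½) (up (up ε)) (up (up X)) (- ½) N)) ⟩
  12ℚ * ((ε ⋆ up (up ε)) N + - ½ * (ε ⋆ up (up X)) N + - ½ * ((X ⋆ up (up ε)) N + - ½ * (X ⋆ up (up X)) N))
    ≡⟨ cong₂ (λ x y → 12ℚ * (x + - ½ * (ε ⋆ up (up X)) N + - ½ * ((X ⋆ up (up ε)) N + - ½ * y))) (even⋆even N alt-ε alt-upupε (cong (λ x → - - - x) h))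
         (trans (X⋆-suc (up (up X)) (suc (suc n))) (trans (cong (ℕ→ℚ N *_) (X-even n h)) (*-zeroʳ (ℕ→ℚ N)))) ⟩
  12ℚ * (0ℚ + - ½ * (ε ⋆ up (up X)) N + - ½ * ((X ⋆ up (up ε)) N + - ½ * 0ℚ))
    ≡⟨ regroup ((ε ⋆ up (up X)) N) ((X ⋆ up (up ε)) N) ⟩
  - 2ℚ * (3ℚ * (ε ⋆ up (up X)) N) + - (+ 6 / 1) * (X ⋆ up (up ε)) N
    ≡⟨ cong₂ (λ x y → - 2ℚ * x + - (+ 6 / 1) * y)
         (trans (cong (3ℚ *_) (⋆-comm ε (up (up X)) N)) (upupX⋆-suc ε (suc (suc n))))
         (trans (X⋆-suc (up (up ε)) (suc (suc n))) (cong (ℕ→ℚ N *_) (ε-even n h))) ⟩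
  - 2ℚ * (ℕ→ℚ N * (up X ⋆ ε) (suc (suc n))) + - (+ 6 / 1) * (ℕ→ℚ N * B n)
    ≡⟨ pull (ℕ→ℚ N) ((up X ⋆ ε) (suc (suc n))) (B n) ⟩
  - ℕ→ℚ N * (2ℚ * (up X ⋆ ε) (suc (suc n)) + (+ 6 / 1) * B n)
    ≡⟨ cong (λ x → - ℕ→ℚ N * (x + (+ 6 / 1) * B n)) (trans (upX⋆-suc ε (suc n)) (cong (ℕ→ℚ (suc (suc n)) *_) (trans (X⋆-suc ε n) (cong (ℕ→ℚ (suc n) *_) (ε-even n h))))) ⟩
  - ℕ→ℚ N * (ℕ→ℚ (suc (suc n)) * (ℕ→ℚ (suc n) * B n) + (+ 6 / 1) * B n)
    ≡⟨ collect (ℕ→ℚ N) (ℕ→ℚ (suc (suc n))) (ℕ→ℚ (suc n)) (B n) ⟩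
  - ℕ→ℚ N * ((ℕ→ℚ (suc (suc n)) * ℕ→ℚ (suc n) + + 6 / 1) * B n) ∎
  where
  N = suc (suc (suc n))
  regroup : ∀ x y → 12ℚ * (0ℚ + - ½ * x + - ½ * (y + - ½ * 0ℚ)) ≡ - 2ℚ * (3ℚ * x) + - (+ 6 / 1) * y
  regroup = solve-∀ ℚ-ring
  pull : ∀ N x b → - 2ℚ * (N * x) + - (+ 6 / 1) * (N * b) ≡ - N * (2ℚ * x + (+ 6 / 1) * b)
  pull = solve-∀ ℚ-ring
  collect : ∀ N m n b → - N * (m * (n * b) + (+ 6 / 1) * b) ≡ - N * ((m * n + + 6 / 1) * b)
  collect = solve-∀ ℚ-ring

-- The coefficient of p

L : ℕ → ℚ
L m = ∑₀ m (λ r → ((+ (suc m C r)) / suc (m ∸ r)) * B r * S (m ∸ r))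

∑₀-1ˢ : ∀ n (f : ℕ → ℚ) → ∑₀ n (λ r → 1ˢ r * f r) ≡ f 0
∑₀-1ˢ zero    f = *-identityˡ (f 0)
∑₀-1ˢ (suc n) f = trans (cong₂ _+_ (∑₀-1ˢ n f) (*-zeroˡ (f (suc n)))) (+-identityʳ (f 0))

∑₀-X : ∀ n (f : ℕ → ℚ) → ∑₀ (suc n) (λ r → X r * f r) ≡ f 1
∑₀-X n f = trans (∑₀-head n (λ r → X r * f r)) (trans (cong₂ _+_ (*-zeroˡ (f 0)) (∑₀-1ˢ n (f ∘ suc))) (+-identityˡ (f 1)))

-- The excluded n = 2 would give B 1 = -½; with m = n + 1 this is why the exponent 3 has its own
-- congruence.
upB-even : ∀ n → sgn n ≡ 1ℚ → n ≢ 2 → up B n ≡ 0ℚ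
upB-even zero    h _   = refl
upB-even (suc n) h n≢2 = B-odd n (trans (neg-involutive (sgn n)) (cong -_ h)) (λ n≡1 → n≢2 (cong suc n≡1))

sgn-cases : ∀ n → sgn n ≡ 1ℚ ⊎ sgn n ≡ - 1ℚ
sgn-cases zero = inj₁ refl
sgn-cases (suc n) with sgn-cases n
... | inj₁ h = inj₂ (cong -_ h)
... | inj₂ h = inj₁ (cong -_ h)

sgn-∸ : ∀ n r → r ≤ n → sgn r ≡ 1ℚ → sgn (n ∸ r) ≡ sgn n
sgn-∸ n       zero          _               h = refl
sgn-∸ _       (suc zero)    _               ()
sgn-∸ (suc (suc n)) (suc (suc r)) (s≤s (s≤s r≤n)) h = trans (sgn-∸ n r r≤n (trans (neg-involutive (sgn r)) h)) (neg-involutive (sgn n))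

-- `S-odd` makes S d a multiple of (d+1)(d+2). One factor cancels the denominator; writing the other
-- as (d+1) + 1 gives two terms, and absorption rewrites the first. In use d = m - r, M = m + 1, c =
-- C(m+1,r) and c′ = C(m,r).
ε-part-even : ∀ M c c′ e d → sgn d ≡ - 1ℚ → suc d ℕ.* c ≡ M ℕ.* c′ →
  4ℚ * (((+ c) / suc d) * e * S d) ≡ - (ℕ→ℚ M * (ℕ→ℚ c′ * e * up B d) + ℕ→ℚ c * e * up B d)
ε-part-even M c c′ e zero    () absorb
ε-part-even M c c′ e (suc j) h  absorb = begin
  4ℚ * (w * e * S (suc j))
    ≡⟨ regroup w e (S (suc j)) ⟩
  w * e * (4ℚ * S (suc j))
    ≡⟨ cong (w * e *_) (S-odd j (trans (neg-involutive (sgn j)) (cong -_ h))) ⟩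
  w * e * (- (J * ℕ→ℚ (suc (suc (suc j)))) * B j)
    ≡⟨ cong (λ x → w * e * (- (J * x) * B j)) (ℕ→ℚ-suc (suc (suc j))) ⟩
  w * e * (- (J * (1ℚ + J)) * B j)
    ≡⟨ expand w e J (B j) ⟩
  - ((J * (w * J)) * (e * B j) + (w * J) * e * B j)
    ≡⟨ cong (λ x → - ((J * x) * (e * B j) + x * e * B j)) (/-*-cancel (+ c) (suc (suc j))) ⟩
  - ((J * ℕ→ℚ c) * (e * B j) + ℕ→ℚ c * e * B j)
    ≡⟨ cong (λ x → - (x * (e * B j) + ℕ→ℚ c * e * B j))
         (trans (sym (ℕ→ℚ-* (suc (suc j)) c)) (trans (cong ℕ→ℚ absorb) (ℕ→ℚ-* M c′))) ⟩
  - ((ℕ→ℚ M * ℕ→ℚ c′) * (e * B j) + ℕ→ℚ c * e * B j)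
    ≡⟨ reassoc (ℕ→ℚ M) (ℕ→ℚ c′) e (B j) (ℕ→ℚ c * e * B j) ⟩
  - (ℕ→ℚ M * (ℕ→ℚ c′ * e * B j) + ℕ→ℚ c * e * B j) ∎
  where
  w = (+ c) / suc (suc j)
  J = ℕ→ℚ (suc (suc j))
  regroup : ∀ w e s → 4ℚ * (w * e * s) ≡ w * e * (4ℚ * s)
  regroup = solve-∀ ℚ-ring
  expand : ∀ w e j b → w * e * (- (j * (1ℚ + j)) * b) ≡ - ((j * (w * j)) * (e * b) + (w * j) * e * b)
  expand = solve-∀ ℚ-ring
  reassoc : ∀ m c e b z → - ((m * c) * (e * b) + z) ≡ - (m * (c * e * b) + z)
  reassoc = solve-∀ ℚ-ring

ε-part-odd : ∀ M w s c c′ b {e} → e ≡ 0ℚ → 4ℚ * (w * e * s) ≡ - (M * (c * e * b) + c′ * e * b)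
ε-part-odd M w s c c′ b refl = lemma M w s c c′ b
  where
  lemma : ∀ M w s c c′ b → 4ℚ * (w * 0ℚ * s) ≡ - (M * (c * 0ℚ * b) + c′ * 0ℚ * b)
  lemma = solve-∀ ℚ-ring

-- For odd m, an even r makes m - r odd, where S is known in closed form, and an odd r contributes
-- nothing because ε r = 0.
ε-part : ∀ m r → sgn m ≡ - 1ℚ → r ≤ m →
  4ℚ * (((+ (suc m C r)) / suc (m ∸ r)) * ε r * S (m ∸ r)) ≡
  - (ℕ→ℚ (suc m) * (ℕ→ℚ (m C r) * ε r * up B (m ∸ r)) + ℕ→ℚ (suc m C r) * ε r * up B (m ∸ r))
ε-part m r h r≤m = [ even , odd ]′ (sgn-cases r)
  where
  even : sgn r ≡ 1ℚ → _
  even e = ε-part-even (suc m) (suc m C r) (m C r) (ε r) (m ∸ r) (trans (sgn-∸ m r r≤m e) h) ([1+n∸k]*[1+n]Ck≡[1+n]*nCk m r r≤m)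
  odd : sgn r ≡ - 1ℚ → _
  odd o = ε-part-odd (ℕ→ℚ (suc m)) ((+ (suc m C r)) / suc (m ∸ r)) (S (m ∸ r)) (ℕ→ℚ (m C r)) (ℕ→ℚ (suc m C r)) (up B (m ∸ r)) (ε-odd r o)

B⋆≡ε⋆ : ∀ b n → (ε ⋆ b) n ≡ (B ⋆ b) n + ½ * (X ⋆ b) n
B⋆≡ε⋆ b n = trans (⋆-distribʳ b B (½ · X) n) (+-congˡ ((B ⋆ b) n) (·-⋆ ½ X b n))

module _ (n : ℕ) (even : sgn n ≡ 1ℚ) (n≢2 : n ≢ 2) where
  private
    m = suc n
    N = suc (suc n)
    wt : ℕ → ℚ
    wt r = (+ (suc m C r)) / suc (m ∸ r)
    Lε = ∑₀ m (λ r → wt r * ε r * S (m ∸ r))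

  -- Replacing B by ε adds ½ (n+1) `up B n`, which is zero by `upB-even`.
  ε⋆upB : (ε ⋆ up B) m ≡ S n
  ε⋆upB = trans (B⋆≡ε⋆ (up B) m) (trans (cong₂ (λ x y → x + ½ * y) (sym (S≡⋆ n)) (trans (X⋆-suc (up B) n) (cong (ℕ→ℚ m *_) (upB-even n even n≢2)))) (tidy (S n) (ℕ→ℚ m)))
    where
    tidy : ∀ s m → s + ½ * (m * 0ℚ) ≡ s
    tidy = solve-∀ ℚ-ring

  ε⋆upupB : (ε ⋆ up (up B)) N ≡ D m
  ε⋆upupB = trans (B⋆≡ε⋆ (up (up B)) N) (trans (cong (λ y → D m + ½ * y) (trans (X⋆-suc (up (up B)) m) (cong (ℕ→ℚ N *_) (upB-even n even n≢2)))) (tidy (D m) (ℕ→ℚ N)))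
    where
    tidy : ∀ s m → s + ½ * (m * 0ℚ) ≡ s
    tidy = solve-∀ ℚ-ring

  -- Summing `ε-part` over r yields two binomial products, with C(m,r) and C(m+1,r); the nested sum
  -- in L thereby collapses to single ones.
  4Lε : 4ℚ * Lε ≡ - (ℕ→ℚ N * S n + D m)
  4Lε = begin
    4ℚ * Lε
      ≡⟨ ∑₀-*ˡ m 4ℚ (λ r → wt r * ε r * S (m ∸ r)) ⟨
    ∑₀ m (λ r → 4ℚ * (wt r * ε r * S (m ∸ r)))
      ≡⟨ ∑₀-cong m (λ r r≤m → trans (ε-part m r (cong -_ even) r≤m) (neg (ℕ→ℚ N * f r) (g r))) ⟩
    ∑₀ m (λ r → - 1ℚ * (ℕ→ℚ N * f r + g r))
      ≡⟨ ∑₀-*ˡ m (- 1ℚ) (λ r → ℕ→ℚ N * f r + g r) ⟩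
    - 1ℚ * ∑₀ m (λ r → ℕ→ℚ N * f r + g r)
      ≡⟨ cong (- 1ℚ *_) (trans (∑₀-+ m (λ r → ℕ→ℚ N * f r) g) (cong₂ _+_ (trans (∑₀-*ˡ m (ℕ→ℚ N) f) (cong (ℕ→ℚ N *_) (trans (sym (binomial-∑ ε (up B) m)) ε⋆upB))) (trans (sym (⋆-up-suc ε (up B) m)) ε⋆upupB))) ⟩
    - 1ℚ * (ℕ→ℚ N * S n + D m)
      ≡⟨ unneg (ℕ→ℚ N * S n + D m) ⟩
    - (ℕ→ℚ N * S n + D m) ∎
    where
    f g : ℕ → ℚ
    f r = ℕ→ℚ (m C r) * ε r * up B (m ∸ r)
    g r = ℕ→ℚ (suc m C r) * ε r * up B (m ∸ r)
    neg : ∀ x y → - (x + y) ≡ - 1ℚ * (x + y)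
    neg = solve-∀ ℚ-ring
    unneg : ∀ x → - 1ℚ * x ≡ - x
    unneg = solve-∀ ℚ-ring

  -- Matiyasevich's identity: the correction term of `convolution-identity` is C(n+2,3) B_{n-1},
  -- which `upB-even` removes.
  2D : ℕ→ℚ N * Q n ≡ 2ℚ * D m
  2D = trans (convolution-identity n) (trans (+-congˡ (2ℚ * D m) correction) (+-identityʳ (2ℚ * D m)))
    where
    correction : (B ⋆ up (up X)) N ≡ 0ℚ
    correction = *-cancel-suc 2 (begin
      3ℚ * (B ⋆ up (up X)) N          ≡⟨ cong (3ℚ *_) (⋆-comm B (up (up X)) N) ⟩
      3ℚ * (up (up X) ⋆ B) N          ≡⟨ upupX⋆-suc B (suc n) ⟩
      ℕ→ℚ N * (up X ⋆ B) (suc n)      ≡⟨ cong (ℕ→ℚ N *_) (*-cancel-suc 1 (begin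
        2ℚ * (up X ⋆ B) (suc n)       ≡⟨ upX⋆-suc B n ⟩
        ℕ→ℚ (suc n) * (X ⋆ B) n       ≡⟨ cong (ℕ→ℚ (suc n) *_) (trans (X⋆≡ B n) (trans (cong (ℕ→ℚ n *_) (upB-even n even n≢2)) (*-zeroʳ (ℕ→ℚ n)))) ⟩
        ℕ→ℚ (suc n) * 0ℚ              ≡⟨ *-zeroʳ (ℕ→ℚ (suc n)) ⟩
        0ℚ                            ≡⟨ *-zeroʳ 2ℚ ⟨
        2ℚ * 0ℚ                       ∎)) ⟩
      ℕ→ℚ N * 0ℚ                      ≡⟨ *-zeroʳ (ℕ→ℚ N) ⟩
      0ℚ                              ≡⟨ *-zeroʳ 3ℚ ⟨
      3ℚ * 0ℚ                         ∎)

  -- B and ε differ only at r = 1, where the weight is C(m+1,1)/m.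
  L-odd : L m ≡ Lε + - ½ * (ℕ→ℚ N * rec m * S n)
  L-odd = begin
    L m
      ≡⟨ ∑₀-cong m (λ r _ → trans (cong (λ b → wt r * b * S (m ∸ r)) (B≡ε r)) (split (wt r) (ε r) (X r) (S (m ∸ r)))) ⟩
    ∑₀ m (λ r → wt r * ε r * S (m ∸ r) + - ½ * (X r * (wt r * S (m ∸ r))))
      ≡⟨ trans (∑₀-+ m (λ r → wt r * ε r * S (m ∸ r)) (λ r → - ½ * (X r * (wt r * S (m ∸ r)))))
           (+-congˡ Lε (trans (∑₀-*ˡ m (- ½) (λ r → X r * (wt r * S (m ∸ r)))) (cong (- ½ *_) (∑₀-X n (λ r → wt r * S (m ∸ r)))))) ⟩
    Lε + - ½ * (wt 1 * S n)
      ≡⟨ cong (λ w → Lε + - ½ * (w * S n)) (trans (/≡*rec (+ (N C 1)) n) (cong (λ c → ℕ→ℚ c * rec m) (nC1≡n N))) ⟩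
    Lε + - ½ * (ℕ→ℚ N * rec m * S n) ∎
    where
    split : ∀ w e x s → w * (e + - ½ * x) * s ≡ w * e * s + - ½ * (x * (w * s))
    split = solve-∀ ℚ-ring

  -- By `L-odd` and `4Lε`, L contributes -½ S n - S n / m - ½ D m / (m+1). Half of the full D m /
  -- (m+1) thus survives, and `2D` turns it into ¼ Q n.
  p-coefficient-odd : ((+ 2) / suc m) * L m + rec (suc m) * D m ≡ μ m
  p-coefficient-odd = begin
    ((+ 2) / N) * L m + i * D m
      ≡⟨ cong₂ (λ x l → x * l + i * D m) (/≡*rec (+ 2) m) L-odd ⟩
    2ℚ * i * (Lε + - ½ * (ℕ→ℚ N * k * S n)) + i * D m
      ≡⟨ regroup i Lε (ℕ→ℚ N) k (S n) (D m) ⟩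
    ½ * i * (4ℚ * Lε) + - (i * ℕ→ℚ N) * (k * S n) + ½ * i * (2ℚ * D m)
      ≡⟨ cong₂ (λ x y → ½ * i * x + - (i * ℕ→ℚ N) * (k * S n) + ½ * i * y) 4Lε (sym 2D) ⟩
    ½ * i * - (ℕ→ℚ N * S n + D m) + - (i * ℕ→ℚ N) * (k * S n) + ½ * i * (ℕ→ℚ N * Q n)
      ≡⟨ regroup₂ i (ℕ→ℚ N) (S n) (D m) k (Q n) ⟩
    (i * ℕ→ℚ N) * (- ½ * S n + - (k * S n) + ½ * Q n) + - ((+ 1) / 4) * (i * (2ℚ * D m))
      ≡⟨ cong (λ x → (i * ℕ→ℚ N) * (- ½ * S n + - (k * S n) + ½ * Q n) + - ((+ 1) / 4) * (i * x)) (sym 2D) ⟩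
    (i * ℕ→ℚ N) * (- ½ * S n + - (k * S n) + ½ * Q n) + - ((+ 1) / 4) * (i * (ℕ→ℚ N * Q n))
      ≡⟨ regroup₃ i (ℕ→ℚ N) (S n) k (Q n) ⟩
    (i * ℕ→ℚ N) * (- ½ * (1ℚ + 2ℚ * k) * S n + ((+ 1) / 4) * Q n)
      ≡⟨ cong₂ (λ x y → x * (- ½ * (y + 2ℚ * k) * S n + ((+ 1) / 4) * Q n)) (rec-inverseˡ m) (sym (rec-inverseˡ n)) ⟩
    1ℚ * (- ½ * (k * ℕ→ℚ m + 2ℚ * k) * S n + ((+ 1) / 4) * Q n)
      ≡⟨ regroup₄ k (ℕ→ℚ m) (S n) (((+ 1) / 4) * Q n) ⟩
    - ((ℕ→ℚ m + 2ℚ) * (½ * k) * S n) + ((+ 1) / 4) * Q n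
      ≡⟨ cong (λ x → - (x * S n) + ((+ 1) / 4) * Q n) quotient ⟨
    μ m ∎
    where
    i = rec (suc m)
    k = rec m
    regroup : ∀ i l N k s a → 2ℚ * i * (l + - ½ * (N * k * s)) + i * a ≡ ½ * i * (4ℚ * l) + - (i * N) * (k * s) + ½ * i * (2ℚ * a)
    regroup = solve-∀ ℚ-ring
    regroup₂ : ∀ i N s a k q → ½ * i * - (N * s + a) + - (i * N) * (k * s) + ½ * i * (N * q) ≡ (i * N) * (- ½ * s + - (k * s) + ½ * q) + - ((+ 1) / 4) * (i * (2ℚ * a))
    regroup₂ = solve-∀ ℚ-ring
    regroup₃ : ∀ i N s k q → (i * N) * (- ½ * s + - (k * s) + ½ * q) + - ((+ 1) / 4) * (i * (N * q)) ≡ (i * N) * (- ½ * (1ℚ + 2ℚ * k) * s + ((+ 1) / 4) * q)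
    regroup₃ = solve-∀ ℚ-ring
    regroup₄ : ∀ k m s q → 1ℚ * (- ½ * (k * m + 2ℚ * k) * s + q) ≡ - ((m + 2ℚ) * (½ * k) * s) + q
    regroup₄ = solve-∀ ℚ-ring
    quotient : (+ (m ℕ.+ 2)) / (2 ℕ.* m) ≡ (ℕ→ℚ m + 2ℚ) * (½ * k)
    -- `2 ℕ.* m` reduces to the successor of the argument given here.
    quotient = *-cancel-suc (n ℕ.+ suc (n ℕ.+ 0)) (begin
      ℕ→ℚ (2 ℕ.* m) * ((+ (m ℕ.+ 2)) / (2 ℕ.* m))     ≡⟨ *-comm (ℕ→ℚ (2 ℕ.* m)) ((+ (m ℕ.+ 2)) / (2 ℕ.* m)) ⟩
      ((+ (m ℕ.+ 2)) / (2 ℕ.* m)) * ℕ→ℚ (2 ℕ.* m)     ≡⟨ /-*-cancel (+ (m ℕ.+ 2)) (2 ℕ.* m) ⟩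
      ℕ→ℚ (m ℕ.+ 2)                                   ≡⟨ ℕ→ℚ-+ m 2 ⟩
      ℕ→ℚ m + 2ℚ                                      ≡⟨ *-identityˡ (ℕ→ℚ m + 2ℚ) ⟨
      1ℚ * (ℕ→ℚ m + 2ℚ)                               ≡⟨ cong (_* (ℕ→ℚ m + 2ℚ)) (rec-inverseˡ n) ⟨
      (k * ℕ→ℚ m) * (ℕ→ℚ m + 2ℚ)                      ≡⟨ lemma k (ℕ→ℚ m) ⟩
      (2ℚ * ℕ→ℚ m) * ((ℕ→ℚ m + 2ℚ) * (½ * k))         ≡⟨ cong (_* ((ℕ→ℚ m + 2ℚ) * (½ * k))) (ℕ→ℚ-* 2 m) ⟨
      ℕ→ℚ (2 ℕ.* m) * ((ℕ→ℚ m + 2ℚ) * (½ * k))        ∎)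
      where
      lemma : ∀ k m → (k * m) * (m + 2ℚ) ≡ (2ℚ * m) * ((m + 2ℚ) * (½ * k))
      lemma = solve-∀ ℚ-ring

-- For even m the sum L enters λ_m unchanged; `D-even` supplies m(m-1) + 6 = m² - m + 6, and its
-- factor m + 1 cancels.
p-coefficient-even : ∀ n → sgn n ≡ 1ℚ → let m = suc (suc n) in ((+ 2) / suc m) * L m + rec (suc m) * D m ≡ λ′ m
p-coefficient-even n h = +-congˡ (((+ 2) / suc m) * L m) (begin
  i * D m
    ≡⟨ pull i (D m) ⟩
  ((+ 1) / 12) * i * (12ℚ * D m)
    ≡⟨ cong (((+ 1) / 12) * i *_) (D-even n h) ⟩
  ((+ 1) / 12) * i * (- ℕ→ℚ (suc m) * ((ℕ→ℚ m * ℕ→ℚ (suc n) + + 6 / 1) * B n))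
    ≡⟨ regroup i (ℕ→ℚ (suc m)) (ℕ→ℚ m * ℕ→ℚ (suc n) + + 6 / 1) (B n) ⟩
  (i * ℕ→ℚ (suc m)) * - ((ℕ→ℚ m * ℕ→ℚ (suc n) + + 6 / 1) * ((+ 1) / 12) * B n)
    ≡⟨ cong (λ x → x * - ((ℕ→ℚ m * ℕ→ℚ (suc n) + + 6 / 1) * ((+ 1) / 12) * B n)) (rec-inverseˡ m) ⟩
  1ℚ * - ((ℕ→ℚ m * ℕ→ℚ (suc n) + + 6 / 1) * ((+ 1) / 12) * B n)
    ≡⟨ *-identityˡ (- ((ℕ→ℚ m * ℕ→ℚ (suc n) + + 6 / 1) * ((+ 1) / 12) * B n)) ⟩
  - ((ℕ→ℚ m * ℕ→ℚ (suc n) + + 6 / 1) * ((+ 1) / 12) * B n)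
    ≡⟨ cong (λ x → - (x * ((+ 1) / 12) * B n)) cast ⟨
  - (ℕ→ℚ (m ℕ.* m ∸ m ℕ.+ 6) * ((+ 1) / 12) * B n)
    ≡⟨ cong (λ x → - (x * B n)) (/≡*rec (+ (m ℕ.* m ∸ m ℕ.+ 6)) 11) ⟨
  - (((+ (m ℕ.* m ∸ m ℕ.+ 6)) / 12) * B n) ∎)
  where
  m = suc (suc n)
  i = rec (suc m)
  pull : ∀ i a → i * a ≡ ((+ 1) / 12) * i * (12ℚ * a)
  pull = solve-∀ ℚ-ring
  regroup : ∀ i M x b → ((+ 1) / 12) * i * (- M * (x * b)) ≡ (i * M) * - (x * ((+ 1) / 12) * b)
  regroup = solve-∀ ℚ-ring
  cast : ℕ→ℚ (m ℕ.* m ∸ m ℕ.+ 6) ≡ ℕ→ℚ m * ℕ→ℚ (suc n) + + 6 / 1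
  cast = trans (ℕ→ℚ-+ (m ℕ.* m ∸ m) 6) (cong (_+ + 6 / 1) (trans (cong ℕ→ℚ (trans (ℕ.m+n∸m≡n m (suc n ℕ.* m)) (ℕ.*-comm (suc n) m))) (ℕ→ℚ-* m (suc n))))

-- With m = n + 1, `S-odd` evaluates ν_m to ((m+2)/2) B_{m-1}.
constant-term-odd : ∀ n → sgn n ≡ 1ℚ → ν (suc n) + - (½ * ℕ→ℚ (suc n) * B n) ≡ B n
constant-term-odd n h = begin
  - (((+ 2) / N) * S (suc n)) + - (½ * ℕ→ℚ (suc n) * B n)
    ≡⟨ cong (λ x → - (x * S (suc n)) + - (½ * ℕ→ℚ (suc n) * B n)) (/≡*rec (+ 2) (suc n)) ⟩
  - (2ℚ * i * S (suc n)) + - (½ * ℕ→ℚ (suc n) * B n)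
    ≡⟨ pull i (S (suc n)) (½ * ℕ→ℚ (suc n) * B n) ⟩
  - (½ * i * (4ℚ * S (suc n))) + - (½ * ℕ→ℚ (suc n) * B n)
    ≡⟨ cong (λ x → - (½ * i * x) + - (½ * ℕ→ℚ (suc n) * B n)) (S-odd n h) ⟩
  - (½ * i * (- (ℕ→ℚ N * ℕ→ℚ (suc N)) * B n)) + - (½ * ℕ→ℚ (suc n) * B n)
    ≡⟨ regroup i (ℕ→ℚ N) (ℕ→ℚ (suc N)) (B n) (½ * ℕ→ℚ (suc n) * B n) ⟩
  (i * ℕ→ℚ N) * (½ * ℕ→ℚ (suc N) * B n) + - (½ * ℕ→ℚ (suc n) * B n)
    ≡⟨ cong₂ (λ x y → x * (½ * y * B n) + - (½ * ℕ→ℚ (suc n) * B n)) (rec-inverseˡ (suc n)) (ℕ→ℚ-+ 2 (suc n)) ⟩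
  1ℚ * (½ * (2ℚ + ℕ→ℚ (suc n)) * B n) + - (½ * ℕ→ℚ (suc n) * B n)
    ≡⟨ cancel (ℕ→ℚ (suc n)) (B n) ⟩
  B n ∎
  where
  N = suc (suc n)
  i = rec N
  pull : ∀ i s z → - (2ℚ * i * s) + - z ≡ - (½ * i * (4ℚ * s)) + - z
  pull = solve-∀ ℚ-ring
  regroup : ∀ i N M b z → - (½ * i * (- (N * M) * b)) + - z ≡ (i * N) * (½ * M * b) + - z
  regroup = solve-∀ ℚ-ring
  cancel : ∀ n b → 1ℚ * (½ * (2ℚ + n) * b) + - (½ * n * b) ≡ b
  cancel = solve-∀ ℚ-ring

-- Power sums

-- The exponential series e^(kt); as 0 ^ 0 = 1, `pow 0` is the unit series.
pow : ℕ → Seq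
pow k n = ℕ→ℚ (k ℕ.^ n)

pow-suc : ∀ k n → pow k (suc n) ≡ ℕ→ℚ k * pow k n
pow-suc k n = ℕ→ℚ-* k (k ℕ.^ n)

pow-⋆E : ∀ k → pow k ⋆ E ≗ pow (suc k)
pow-⋆E k zero    = refl
pow-⋆E k (suc n) = begin
  ((pow k ∘ suc) ⋆ E) n + (pow k ⋆ E) n    ≡⟨ cong (_+ (pow k ⋆ E) n) (trans (⋆-congʳ (pow-suc k) n) (·-⋆ (ℕ→ℚ k) (pow k) E n)) ⟩
  ℕ→ℚ k * (pow k ⋆ E) n + (pow k ⋆ E) n    ≡⟨ cong (λ x → ℕ→ℚ k * x + x) (pow-⋆E k n) ⟩
  ℕ→ℚ k * pow (suc k) n + pow (suc k) n    ≡⟨ lemma (ℕ→ℚ k) (pow (suc k) n) ⟩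
  (1ℚ + ℕ→ℚ k) * pow (suc k) n             ≡⟨ cong (_* pow (suc k) n) (ℕ→ℚ-suc k) ⟨
  ℕ→ℚ (suc k) * pow (suc k) n              ≡⟨ pow-suc (suc k) n ⟨
  pow (suc k) (suc n)                      ∎
  where
  lemma : ∀ x y → x * y + y ≡ (1ℚ + x) * y
  lemma = solve-∀ ℚ-ring

pow-0 : pow 0 ≗ 1ˢ
pow-0 zero    = refl
pow-0 (suc n) = refl

-- The sum starts with 0ⁿ, which is 1 for n = 0.
F : ℕ → Seq
F zero    = 0ˢ
F (suc k) = F k ⊕ pow k

-- Since t = B(t) (eᵗ - 1), t times the geometric sum of the e^(jt), j < k, is B(t) (e^(kt) - 1).
X⋆F : ∀ k n → (X ⋆ F k) n + B n ≡ (B ⋆ pow k) n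
X⋆F zero    n = begin
  (X ⋆ 0ˢ) n + B n        ≡⟨ cong (_+ B n) (⋆-zeroʳ X n) ⟩
  0ℚ + B n                ≡⟨ +-identityˡ (B n) ⟩
  B n                     ≡⟨ ⋆-identityʳ B n ⟨
  (B ⋆ 1ˢ) n              ≡⟨ ⋆-congˡ pow-0 n ⟨
  (B ⋆ pow 0) n           ∎
X⋆F (suc k) n = begin
  (X ⋆ (F k ⊕ pow k)) n + B n              ≡⟨ cong (_+ B n) (⋆-distribˡ X (F k) (pow k) n) ⟩
  (X ⋆ F k) n + (X ⋆ pow k) n + B n        ≡⟨ swap ((X ⋆ F k) n) ((X ⋆ pow k) n) (B n) ⟩
  (X ⋆ F k) n + B n + (X ⋆ pow k) n        ≡⟨ cong (_+ (X ⋆ pow k) n) (X⋆F k n) ⟩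
  (B ⋆ pow k) n + (X ⋆ pow k) n            ≡⟨ ⋆-distribʳ (pow k) B X n ⟨
  ((B ⊕ X) ⋆ pow k) n                      ≡⟨ ⋆-congʳ B⋆E n ⟨
  ((B ⋆ E) ⋆ pow k) n                      ≡⟨ ⋆-assoc B E (pow k) n ⟩
  (B ⋆ (E ⋆ pow k)) n                      ≡⟨ ⋆-congˡ (λ j → trans (⋆-comm E (pow k) j) (pow-⋆E k j)) n ⟩
  (B ⋆ pow (suc k)) n                      ∎
  where
  swap : ∀ x y z → x + y + z ≡ x + z + y
  swap = solve-∀ ℚ-ring

coef : ℕ → ℕ → ℚ
coef n r = rec (suc n) * ℕ→ℚ (suc n C r) * B r

G : ℕ → ℕ → ℚ
G n k = ∑₀ n (λ r → coef n r * pow k (n ∸ r))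

coef-diag : ∀ n → coef n n ≡ B n
coef-diag n = trans (cong (λ c → rec (suc n) * ℕ→ℚ c * B n) ([1+n]Cn≡1+n n)) (trans (cong (_* B n) (rec-inverseˡ n)) (*-identityˡ (B n)))

-- Take index n + 1 in `X⋆F`: the term r = n + 1 is B (n+1) and cancels, and all remaining powers of
-- k have positive exponent, which releases the factor k.
faulhaber : ∀ k n → F k n ≡ ℕ→ℚ k * G n k
faulhaber k n = *-cancel-suc n (begin
  ℕ→ℚ (suc n) * F k n
    ≡⟨ X⋆-suc (F k) n ⟨
  (X ⋆ F k) (suc n)
    ≡⟨ x+y≡z+y⇒x≡z (B (suc n)) (begin
    (X ⋆ F k) (suc n) + B (suc n)                    ≡⟨ X⋆F k (suc n) ⟩
    (B ⋆ pow k) (suc n)                              ≡⟨ binomial-∑ B (pow k) (suc n) ⟩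
    ∑₀ n f + ℕ→ℚ (suc n C suc n) * B (suc n) * pow k (n ∸ n)
      ≡⟨ +-congˡ (∑₀ n f) (cong₂ (λ c j → ℕ→ℚ c * B (suc n) * pow k j) (nCn≡1 (suc n)) (ℕ.n∸n≡0 n)) ⟩
    ∑₀ n f + 1ℚ * B (suc n) * 1ℚ                     ≡⟨ +-congˡ (∑₀ n f) (tidy (B (suc n))) ⟩
    ∑₀ n f + B (suc n)                               ∎) ⟩
  ∑₀ n f
    ≡⟨ ∑₀-cong n term ⟩
  ∑₀ n (λ r → (ℕ→ℚ (suc n) * ℕ→ℚ k) * (coef n r * pow k (n ∸ r)))
    ≡⟨ ∑₀-*ˡ n (ℕ→ℚ (suc n) * ℕ→ℚ k) (λ r → coef n r * pow k (n ∸ r)) ⟩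
  (ℕ→ℚ (suc n) * ℕ→ℚ k) * G n k
    ≡⟨ *-assoc (ℕ→ℚ (suc n)) (ℕ→ℚ k) (G n k) ⟩
  ℕ→ℚ (suc n) * (ℕ→ℚ k * G n k) ∎)
  where
  f : ℕ → ℚ
  f r = ℕ→ℚ (suc n C r) * B r * pow k (suc n ∸ r)
  tidy : ∀ x → 1ℚ * x * 1ℚ ≡ x
  tidy = solve-∀ ℚ-ring
  x+y≡z+y⇒x≡z : ∀ y {x z} → x + y ≡ z + y → x ≡ z
  x+y≡z+y⇒x≡z y {x} {z} h = trans (l x y) (trans (cong (_- y) h) (sym (l z y)))
    where
    l : ∀ x y → x ≡ (x + y) - y
    l = solve-∀ ℚ-ring
  term : ∀ r → r ≤ n → f r ≡ (ℕ→ℚ (suc n) * ℕ→ℚ k) * (coef n r * pow k (n ∸ r))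
  term r r≤n = begin
    c * b * pow k (suc n ∸ r)                          ≡⟨ cong (λ j → c * b * pow k j) (ℕ.+-∸-assoc 1 r≤n) ⟩
    c * b * pow k (suc (n ∸ r))                        ≡⟨ cong (c * b *_) (pow-suc k (n ∸ r)) ⟩
    c * b * (ℕ→ℚ k * pow k (n ∸ r))                    ≡⟨ *-identityˡ (c * b * (ℕ→ℚ k * pow k (n ∸ r))) ⟨
    1ℚ * (c * b * (ℕ→ℚ k * pow k (n ∸ r)))             ≡⟨ cong (_* (c * b * (ℕ→ℚ k * pow k (n ∸ r)))) (rec-inverseˡ n) ⟨
    (rec (suc n) * ℕ→ℚ (suc n)) * (c * b * (ℕ→ℚ k * pow k (n ∸ r)))
      ≡⟨ regroup (rec (suc n)) (ℕ→ℚ (suc n)) c b (ℕ→ℚ k) (pow k (n ∸ r)) ⟩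
    (ℕ→ℚ (suc n) * ℕ→ℚ k) * (coef n r * pow k (n ∸ r)) ∎
    where
    c = ℕ→ℚ (suc n C r)
    b = B r
    regroup : ∀ i n c b k w → (i * n) * (c * b * (k * w)) ≡ (n * k) * (i * c * b * w)
    regroup = solve-∀ ℚ-ring

F≡1ˢ+∑₁ : ∀ N n → F (suc N) n ≡ 1ˢ n + ∑₁ N (λ k → pow k n)
F≡1ˢ+∑₁ zero    n = trans (+-identityˡ (pow 0 n)) (trans (pow-0 n) (sym (+-identityʳ (1ˢ n))))
F≡1ˢ+∑₁ (suc N) n = trans (cong (_+ pow (suc N) n) (F≡1ˢ+∑₁ N n)) (+-assoc (1ˢ n) (∑₁ N (λ k → pow k n)) (pow (suc N) n))

-- Summation by parts

-- The jump 1/k of H at k meets F k n = k G n k and so contributes G n k. The term 0ⁿ included in F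
-- is harmless because H 0 = 0.
∑-pow*H : ∀ N n → ∑₁ N (λ k → pow k n * H k) ≡ F (suc N) n * H N - ∑₁ N (λ k → G n k)
∑-pow*H zero    n = sym (lemma (F 1 n))
  where
  lemma : ∀ x → x * 0ℚ - 0ℚ ≡ 0ℚ
  lemma = solve-∀ ℚ-ring
∑-pow*H (suc N) n = begin
  ∑₁ N (λ k → pow k n * H k) + w * (h + r)          ≡⟨ cong (_+ w * (h + r)) (∑-pow*H N n) ⟩
  F (suc N) n * h - s + w * (h + r)                 ≡⟨ cong (λ f → f * h - s + w * (h + r)) (faulhaber (suc N) n) ⟩
  M * g * h - s + w * (h + r)                       ≡⟨ lemma₁ M g h s w r ⟩
  (M * g + w) * (h + r) - (s + (r * M) * g)         ≡⟨ cong₂ (λ f x → (f + w) * (h + r) - (s + x * g)) (sym (faulhaber (suc N) n)) (rec-inverseˡ N) ⟩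
  (F (suc N) n + w) * (h + r) - (s + 1ℚ * g)        ≡⟨ cong (λ x → (F (suc N) n + w) * (h + r) - (s + x)) (*-identityˡ g) ⟩
  (F (suc N) n + w) * (h + r) - (s + g)             ∎
  where
  w = pow (suc N) n
  h = H N
  r = rec (suc N)
  s = ∑₁ N (λ k → G n k)
  g = G n (suc N)
  M = ℕ→ℚ (suc N)
  lemma₁ : ∀ M g h s w r → M * g * h - s + w * (h + r) ≡ (M * g + w) * (h + r) - (s + (r * M) * g)
  lemma₁ = solve-∀ ℚ-ring

-- The square of H jumps at k by (2 H_k - 1/k)/k, and the division by k again turns F into G.
∑-pow*H*H : ∀ N m → T (suc N) m ≡ F (suc N) m * (H N * H N) - ∑₁ N (λ k → G m k * (2ℚ * H k - rec k))
∑-pow*H*H zero    m = sym (lemma (F 1 m))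
  where
  lemma : ∀ x → x * (0ℚ * 0ℚ) - 0ℚ ≡ 0ℚ
  lemma = solve-∀ ℚ-ring
∑-pow*H*H (suc N) m = begin
  T (suc N) m + w * h′ * h′                               ≡⟨ cong (_+ w * h′ * h′) (∑-pow*H*H N m) ⟩
  F (suc N) m * (h * h) - s + w * h′ * h′                 ≡⟨ cong (λ f → f * (h * h) - s + w * h′ * h′) (faulhaber (suc N) m) ⟩
  M * g * (h * h) - s + w * (h + r) * (h + r)             ≡⟨ lemma₁ M g h s w r ⟩
  (M * g + w) * ((h + r) * (h + r)) - (s + (r * M) * (g * (2ℚ * (h + r) - r)))
    ≡⟨ cong₂ (λ f x → (f + w) * (h′ * h′) - (s + x * (g * (2ℚ * h′ - r)))) (sym (faulhaber (suc N) m)) (rec-inverseˡ N) ⟩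
  (F (suc N) m + w) * (h′ * h′) - (s + 1ℚ * (g * (2ℚ * h′ - r)))
    ≡⟨ cong (λ x → (F (suc N) m + w) * (h′ * h′) - (s + x)) (*-identityˡ (g * (2ℚ * h′ - r))) ⟩
  (F (suc N) m + w) * (h′ * h′) - (s + g * (2ℚ * h′ - r)) ∎
  where
  w = pow (suc N) m
  h = H N
  h′ = H (suc N)
  r = rec (suc N)
  s = ∑₁ N (λ k → G m k * (2ℚ * H k - rec k))
  g = G m (suc N)
  M = ℕ→ℚ (suc N)
  lemma₁ : ∀ M g h s w r → M * g * (h * h) - s + w * (h + r) * (h + r) ≡ (M * g + w) * ((h + r) * (h + r)) - (s + (r * M) * (g * (2ℚ * (h + r) - r)))
  lemma₁ = solve-∀ ℚ-ring

-- p-integral rationals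

module Local (p : ℕ) (pr : Prime p) where

  -- The denominator need not be the reduced one, so sums and products simply multiply denominators;
  -- `cross` makes the passage to lowest terms.
  record Integral (x : ℚ) : Set where
    constructor integral
    field
      den   : ℕ
      num   : ℤ
      p∤den : ¬ (p ∣ den)
      clear : x * ℕ→ℚ den ≡ num / 1

  p∤* : ∀ m n → ¬ (p ∣ m) → ¬ (p ∣ n) → ¬ (p ∣ m ℕ.* n)
  p∤* m n p∤m p∤n h = [ p∤m , p∤n ]′ (euclidsLemma m n pr h)

  p∤1 : ¬ (p ∣ 1)
  p∤1 h = ¬prime[1] (subst Prime (∣1⇒≡1 h) pr)

  Integral-/1 : ∀ i → Integral (i / 1)
  Integral-/1 i = integral 1 i p∤1 (*-identityʳ (i / 1))

  Integral-ℕ : ∀ n → Integral (ℕ→ℚ n)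
  Integral-ℕ n = Integral-/1 (+ n)

  Integral-+ : ∀ {x y} → Integral x → Integral y → Integral (x + y)
  Integral-+ {x} {y} (integral d n h e) (integral d′ n′ h′ e′) = integral (d ℕ.* d′) (n ℤ.* + d′ ℤ.+ n′ ℤ.* + d) (p∤* d d′ h h′) (begin
    (x + y) * ℕ→ℚ (d ℕ.* d′)                             ≡⟨ cong ((x + y) *_) (ℕ→ℚ-* d d′) ⟩
    (x + y) * (ℕ→ℚ d * ℕ→ℚ d′)                           ≡⟨ lemma x y (ℕ→ℚ d) (ℕ→ℚ d′) ⟩
    (x * ℕ→ℚ d) * ℕ→ℚ d′ + (y * ℕ→ℚ d′) * ℕ→ℚ d          ≡⟨ cong₂ (λ a b → a * ℕ→ℚ d′ + b * ℕ→ℚ d) e e′ ⟩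
    (n / 1) * ℕ→ℚ d′ + (n′ / 1) * ℕ→ℚ d                  ≡⟨ cong₂ _+_ (/1-* n (+ d′)) (/1-* n′ (+ d)) ⟨
    (n ℤ.* + d′) / 1 + (n′ ℤ.* + d) / 1                  ≡⟨ /1-+ (n ℤ.* + d′) (n′ ℤ.* + d) ⟨
    (n ℤ.* + d′ ℤ.+ n′ ℤ.* + d) / 1                      ∎)
    where
    lemma : ∀ x y d d′ → (x + y) * (d * d′) ≡ (x * d) * d′ + (y * d′) * d
    lemma = solve-∀ ℚ-ring

  Integral-* : ∀ {x y} → Integral x → Integral y → Integral (x * y)
  Integral-* {x} {y} (integral d n h e) (integral d′ n′ h′ e′) = integral (d ℕ.* d′) (n ℤ.* n′) (p∤* d d′ h h′) (begin
    (x * y) * ℕ→ℚ (d ℕ.* d′)              ≡⟨ cong ((x * y) *_) (ℕ→ℚ-* d d′) ⟩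
    (x * y) * (ℕ→ℚ d * ℕ→ℚ d′)            ≡⟨ lemma x y (ℕ→ℚ d) (ℕ→ℚ d′) ⟩
    (x * ℕ→ℚ d) * (y * ℕ→ℚ d′)            ≡⟨ cong₂ _*_ e e′ ⟩
    (n / 1) * (n′ / 1)                    ≡⟨ /1-* n n′ ⟨
    (n ℤ.* n′) / 1                        ∎)
    where
    lemma : ∀ x y d d′ → (x * y) * (d * d′) ≡ (x * d) * (y * d′)
    lemma = solve-∀ ℚ-ring

  Integral-neg : ∀ {x} → Integral x → Integral (- x)
  Integral-neg {x} h = subst Integral (lemma x) (Integral-* (Integral-/1 -[1+ 0 ]) h)
    where
    lemma : ∀ x → - 1ℚ * x ≡ - x
    lemma = solve-∀ ℚ-ring

  Integral-/ : ∀ i d .{{_ : ℕ.NonZero d}} → ¬ (p ∣ d) → Integral (i / d)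
  Integral-/ i d p∤d = integral d i p∤d (/-*-cancel i d)

  Integral-rec : ∀ n → suc n < p → Integral (rec (suc n))
  Integral-rec n n<p = Integral-/ (+ 1) (suc n) (>⇒∤ n<p)

  Integral-∑₀ : ∀ n {f : ℕ → ℚ} → (∀ r → r ≤ n → Integral (f r)) → Integral (∑₀ n f)
  Integral-∑₀ zero    h = h 0 z≤n
  Integral-∑₀ (suc n) h = Integral-+ (Integral-∑₀ n (λ r r≤n → h r (ℕ.m≤n⇒m≤1+n r≤n))) (h (suc n) ℕ.≤-refl)

  Integral-∑₁ : ∀ n {f : ℕ → ℚ} → (∀ k → k < n → Integral (f (suc k))) → Integral (∑₁ n f)
  Integral-∑₁ zero    h = Integral-ℕ 0
  Integral-∑₁ (suc n) h = Integral-+ (Integral-∑₁ n (λ k k<n → h k (ℕ.m<n⇒m<1+n k<n))) (h n ℕ.≤-refl)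

  ↥-clear : ∀ x → x * ℕ→ℚ (↧ₙ x) ≡ ↥ x / 1
  ↥-clear x@record{} = trans (cong (_* ℕ→ℚ (↧ₙ x)) (sym (↥p/↧p≡p x))) (/-*-cancel (↥ x) (↧ₙ x))

  cross : ∀ x d n → x * ℕ→ℚ d ≡ n / 1 → ℤ.∣ ↥ x ∣ ℕ.* d ≡ ℤ.∣ n ∣ ℕ.* ↧ₙ x
  cross x d n e = trans (sym (ℤ.abs-* (↥ x) (+ d))) (trans (cong ℤ.∣_∣ (/1-injective {↥ x ℤ.* + d} {n ℤ.* + ↧ₙ x} eq)) (ℤ.abs-* n (+ ↧ₙ x)))
    where
    swap : ∀ x d c → (x * c) * d ≡ (x * d) * c
    swap = solve-∀ ℚ-ring
    eq : (↥ x ℤ.* + d) / 1 ≡ (n ℤ.* + ↧ₙ x) / 1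
    eq = begin
      (↥ x ℤ.* + d) / 1             ≡⟨ /1-* (↥ x) (+ d) ⟩
      (↥ x / 1) * ℕ→ℚ d             ≡⟨ cong (_* ℕ→ℚ d) (↥-clear x) ⟨
      (x * ℕ→ℚ (↧ₙ x)) * ℕ→ℚ d      ≡⟨ swap x (ℕ→ℚ d) (ℕ→ℚ (↧ₙ x)) ⟩
      (x * ℕ→ℚ d) * ℕ→ℚ (↧ₙ x)      ≡⟨ cong (_* ℕ→ℚ (↧ₙ x)) e ⟩
      (n / 1) * ℕ→ℚ (↧ₙ x)          ≡⟨ /1-* n (+ ↧ₙ x) ⟨
      (n ℤ.* + ↧ₙ x) / 1            ∎

  -- If p divided the reduced denominator, `cross` and Euclid's lemma would make p divide the
  -- coprime numerator or `den`.
  Integral⇒p∤↧ : ∀ x → Integral x → ¬ (p ∣ ↧ₙ x)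
  Integral⇒p∤↧ x (integral d n p∤d e) p∣↧ =
    [ (λ p∣↥ → p∤1 (subst (p ∣_) (coprime x (p∣↥ , p∣↧)) ∣-refl)) , p∤d ]′
      (euclidsLemma ℤ.∣ ↥ x ∣ d pr (subst (p ∣_) (sym (cross x d n e)) (∣n⇒∣m*n ℤ.∣ n ∣ p∣↧)))
    where
    coprime : ∀ x → Coprimality.Coprime ℤ.∣ ↥ x ∣ (↧ₙ x)
    coprime (mkℚ _ _ c) = Coprimality.recompute c

  p^e∣-cancel : ∀ e m d → ¬ (p ∣ d) → p ℕ.^ e ∣ m ℕ.* d → p ℕ.^ e ∣ m
  p^e∣-cancel zero    m d p∤d h = 1∣ m
  p^e∣-cancel (suc e) m d p∤d h with euclidsLemma m d pr (∣-trans (m∣m*n (p ℕ.^ e)) h)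
  ... | inj₂ p∣d = ⊥-elim (p∤d p∣d)
  ... | inj₁ (divides k refl) = subst (p ℕ.^ suc e ∣_) (ℕ.*-comm p k) (*-monoʳ-∣ p (p^e∣-cancel e k d p∤d
          (*-cancelˡ-∣ p {{prime⇒nonZero pr}} (subst (p ℕ.^ suc e ∣_) (trans (cong (ℕ._* d) (ℕ.*-comm k p)) (ℕ.*-assoc p k d)) h))))

  infix 4 _≡_⟨mod_⟩
  -- The modulus is an arbitrary rational, so `mod-scale` can lift a congruence mod p to one mod p²
  -- by multiplying it by p.
  record _≡_⟨mod_⟩ (x y m : ℚ) : Set where
    constructor congruent
    field
      quot    : ℚ
      quot-integral : Integral quot
      x≡y+mq  : x ≡ y + m * quot

  ≡⟨mod⟩⇒≡[mod^] : ∀ e {x y} → Integral x → Integral y → x ≡ y ⟨mod ℕ→ℚ (p ℕ.^ e) ⟩ → x ≡ y [mod p ^ e ]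
  ≡⟨mod⟩⇒≡[mod^] e {x} {y} ix iy (congruent u (integral d n p∤d clear) eq) =
    Integral⇒p∤↧ x ix , Integral⇒p∤↧ y iy ,
    p^e∣-cancel e ℤ.∣ ↥ (x - y) ∣ d p∤d
      (subst (p ℕ.^ e ∣_) (sym (trans (cross (x - y) d (+ (p ℕ.^ e) ℤ.* n) diff) (cong (ℕ._* ↧ₙ (x - y)) (ℤ.abs-* (+ (p ℕ.^ e)) n))))
        (∣m⇒∣m*n (↧ₙ (x - y)) (∣m⇒∣m*n ℤ.∣ n ∣ ∣-refl)))
    where
    M = ℕ→ℚ (p ℕ.^ e)
    lemma : ∀ y m u d → ((y + m * u) - y) * d ≡ m * (u * d)
    lemma = solve-∀ ℚ-ring
    diff : (x - y) * ℕ→ℚ d ≡ (+ (p ℕ.^ e) ℤ.* n) / 1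
    diff = begin
      (x - y) * ℕ→ℚ d               ≡⟨ cong (λ z → (z - y) * ℕ→ℚ d) eq ⟩
      ((y + M * u) - y) * ℕ→ℚ d     ≡⟨ lemma y M u (ℕ→ℚ d) ⟩
      M * (u * ℕ→ℚ d)               ≡⟨ cong (M *_) clear ⟩
      M * (n / 1)                   ≡⟨ /1-* (+ (p ℕ.^ e)) n ⟨
      (+ (p ℕ.^ e) ℤ.* n) / 1       ∎

  module _ {m : ℚ} where

    ≡⇒mod : ∀ {x y} → x ≡ y → x ≡ y ⟨mod m ⟩
    ≡⇒mod {x} refl = congruent 0ℚ (Integral-ℕ 0) (lemma x m)
      where
      lemma : ∀ x m → x ≡ x + m * 0ℚ
      lemma = solve-∀ ℚ-ring

    mod-trans : ∀ {x y z} → x ≡ y ⟨mod m ⟩ → y ≡ z ⟨mod m ⟩ → x ≡ z ⟨mod m ⟩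
    mod-trans {x} {y} {z} (congruent u iu e) (congruent v iv e′) = congruent (v + u) (Integral-+ iv iu)
      (trans e (trans (cong (_+ m * u) e′) (lemma z m u v)))
      where
      lemma : ∀ z m u v → (z + m * v) + m * u ≡ z + m * (v + u)
      lemma = solve-∀ ℚ-ring

    mod-sym : ∀ {x y} → x ≡ y ⟨mod m ⟩ → y ≡ x ⟨mod m ⟩
    mod-sym {x} {y} (congruent u iu e) = congruent (- u) (Integral-neg iu) (trans (lemma y m u) (cong (_+ m * - u) (sym e)))
      where
      lemma : ∀ y m u → y ≡ (y + m * u) + m * - u
      lemma = solve-∀ ℚ-ring

    mod-+ : ∀ {x x′ y y′} → x ≡ x′ ⟨mod m ⟩ → y ≡ y′ ⟨mod m ⟩ → x + y ≡ x′ + y′ ⟨mod m ⟩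
    mod-+ {x} {x′} {y} {y′} (congruent u iu e) (congruent v iv e′) = congruent (u + v) (Integral-+ iu iv)
      (trans (cong₂ _+_ e e′) (lemma x′ y′ m u v))
      where
      lemma : ∀ x y m u v → (x + m * u) + (y + m * v) ≡ (x + y) + m * (u + v)
      lemma = solve-∀ ℚ-ring

    mod-*ˡ : ∀ {c x y} → Integral c → x ≡ y ⟨mod m ⟩ → c * x ≡ c * y ⟨mod m ⟩
    mod-*ˡ {c} {x} {y} ic (congruent u iu e) = congruent (c * u) (Integral-* ic iu) (trans (cong (c *_) e) (lemma c y m u))
      where
      lemma : ∀ c y m u → c * (y + m * u) ≡ c * y + m * (c * u)
      lemma = solve-∀ ℚ-ring

    mod-neg : ∀ {x y} → x ≡ y ⟨mod m ⟩ → - x ≡ - y ⟨mod m ⟩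
    mod-neg {x} {y} (congruent u iu e) = congruent (- u) (Integral-neg iu) (trans (cong -_ e) (lemma y m u))
      where
      lemma : ∀ y m u → - (y + m * u) ≡ - y + m * - u
      lemma = solve-∀ ℚ-ring

    mod-∑₀ : ∀ n {f g : ℕ → ℚ} → (∀ r → r ≤ n → f r ≡ g r ⟨mod m ⟩) → ∑₀ n f ≡ ∑₀ n g ⟨mod m ⟩
    mod-∑₀ zero    h = h 0 z≤n
    mod-∑₀ (suc n) h = mod-+ (mod-∑₀ n (λ r r≤n → h r (ℕ.m≤n⇒m≤1+n r≤n))) (h (suc n) ℕ.≤-refl)

    mod-∑₁ : ∀ n {f g : ℕ → ℚ} → (∀ k → k < n → f (suc k) ≡ g (suc k) ⟨mod m ⟩) → ∑₁ n f ≡ ∑₁ n g ⟨mod m ⟩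
    mod-∑₁ zero    h = ≡⇒mod refl
    mod-∑₁ (suc n) h = mod-+ (mod-∑₁ n (λ k k<n → h k (ℕ.m<n⇒m<1+n k<n))) (h n ℕ.≤-refl)

    multiple≡0 : ∀ {x u} → Integral u → x ≡ m * u → x ≡ 0ℚ ⟨mod m ⟩
    multiple≡0 {x} {u} iu e = congruent u iu (trans e (sym (+-identityˡ (m * u))))

  mod-scale : ∀ {m x y} c → x ≡ y ⟨mod m ⟩ → c * x ≡ c * y ⟨mod c * m ⟩
  mod-scale {m} {x} {y} c (congruent u iu e) = congruent u iu (trans (cong (c *_) e) (lemma c y m u))
    where
    lemma : ∀ c y m u → c * (y + m * u) ≡ c * y + (c * m) * u
    lemma = solve-∀ ℚ-ring

  mod-weaken : ∀ {c m x y} → Integral c → x ≡ y ⟨mod c * m ⟩ → x ≡ y ⟨mod m ⟩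
  mod-weaken {c} {m} {x} {y} ic (congruent u iu e) = congruent (c * u) (Integral-* ic iu) (trans e (lemma c y m u))
    where
    lemma : ∀ c y m u → y + (c * m) * u ≡ y + m * (c * u)
    lemma = solve-∀ ℚ-ring

-- Reversed sums and pairs of reciprocals

∑₀-diagonal : ∀ n (f : ℕ → ℚ) → ∑₀ n (λ r → 1ˢ (n ∸ r) * f r) ≡ f n
∑₀-diagonal n f = trans (∑₀-reverse n (λ r → 1ˢ (n ∸ r) * f r))
  (trans (∑₀-cong n (λ r r≤n → cong (λ j → 1ˢ j * f (n ∸ r)) (ℕ.m∸[m∸n]≡n r≤n))) (∑₀-1ˢ n (λ r → f (n ∸ r))))

∑₁-head : ∀ n (f : ℕ → ℚ) → ∑₁ (suc n) f ≡ f 1 + ∑₁ n (f ∘ suc)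
∑₁-head zero    f = trans (+-identityˡ (f 1)) (sym (+-identityʳ (f 1)))
∑₁-head (suc n) f = trans (cong (_+ f (suc (suc n))) (∑₁-head n f)) (+-assoc (f 1) (∑₁ n (f ∘ suc)) (f (suc (suc n))))

∑₁-reverse : ∀ n (f : ℕ → ℚ) → ∑₁ n f ≡ ∑₁ n (λ k → f (suc n ∸ k))
∑₁-reverse zero    f = refl
∑₁-reverse (suc n) f = begin
  ∑₁ n f + f (suc n)                        ≡⟨ +-comm (∑₁ n f) (f (suc n)) ⟩
  f (suc n) + ∑₁ n f                        ≡⟨ +-congˡ (f (suc n)) (∑₁-reverse n f) ⟩
  f (suc n) + ∑₁ n (λ k → f (suc n ∸ k))    ≡⟨ ∑₁-head n (λ k → f (suc (suc n) ∸ k)) ⟨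
  ∑₁ (suc n) (λ k → f (suc (suc n) ∸ k))    ∎

H≡∑rec : ∀ n → H n ≡ ∑₁ n rec
H≡∑rec zero    = refl
H≡∑rec (suc n) = cong (_+ rec (suc n)) (H≡∑rec n)

-- From x + y = p x y with y written as (x + y) - x; a second use of the same identity isolates the
-- term with p².
rec-pair : ∀ a b → let p = ℕ→ℚ (suc a ℕ.+ suc b); x = rec (suc a); y = rec (suc b) in
  x + y ≡ - p * (x * x) + p * p * (x * x * y)
rec-pair a b = begin
  x + y                                          ≡⟨ sum ⟩
  p * x * y                                      ≡⟨ expand p x y ⟩
  - p * (x * x) + p * ((x + y) * x)              ≡⟨ cong (λ z → - p * (x * x) + p * (z * x)) sum ⟩
  - p * (x * x) + p * (p * x * y * x)            ≡⟨ regroup p x y ⟩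
  - p * (x * x) + p * p * (x * x * y)            ∎
  where
  p = ℕ→ℚ (suc a ℕ.+ suc b)
  x = rec (suc a)
  y = rec (suc b)
  expand : ∀ s x y → s * x * y ≡ - s * (x * x) + s * ((x + y) * x)
  expand = solve-∀ ℚ-ring
  regroup : ∀ s x y → - s * (x * x) + s * (s * x * y * x) ≡ - s * (x * x) + s * s * (x * x * y)
  regroup = solve-∀ ℚ-ring
  sum : x + y ≡ p * x * y
  sum = begin
    x + y                                            ≡⟨ cong₂ _+_ (*-identityʳ x) (*-identityʳ y) ⟨
    x * 1ℚ + y * 1ℚ                                  ≡⟨ cong₂ (λ s t → x * s + y * t) (rec-inverseˡ b) (rec-inverseˡ a) ⟨
    x * (y * ℕ→ℚ (suc b)) + y * (x * ℕ→ℚ (suc a))    ≡⟨ collect x y (ℕ→ℚ (suc a)) (ℕ→ℚ (suc b)) ⟩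
    (ℕ→ℚ (suc a) + ℕ→ℚ (suc b)) * x * y              ≡⟨ cong (λ z → z * x * y) (ℕ→ℚ-+ (suc a) (suc b)) ⟨
    p * x * y                                        ∎
    where
    collect : ∀ x y a b → x * (y * b) + y * (x * a) ≡ (a + b) * x * y
    collect = solve-∀ ℚ-ring

-- Congruences modulo p and p²

module Congruences (q : ℕ) (pr : Prime (4 ℕ.+ q)) where

  -- `N` is p - 1 and `suc q` is p - 3, both in constructor form.
  p N : ℕ
  p = suc (suc (suc (suc q)))
  N = suc (suc (suc q))

  open Local p pr

  P : ℚ
  P = ℕ→ℚ p

  -- Strong induction along the recurrence: B (n+1) arises by division by n + 2, and n + 1 < p - 1
  -- keeps this below p.
  B-integral-upto : ∀ n → n < N → ∀ r → r ≤ n → Integral (B r)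
  B-integral-upto zero    _   zero z≤n = Integral-ℕ 1
  B-integral-upto (suc n) n<N r r≤n = [ (λ r<n → IH r (ℕ.≤-pred r<n)) , (λ r≡n → subst (λ j → Integral (B j)) (sym r≡n) step) ]′ (ℕ.m≤n⇒m<n∨m≡n r≤n)
    where
    IH : ∀ r → r ≤ n → Integral (B r)
    IH = B-integral-upto n (ℕ.<-trans (ℕ.n<1+n n) n<N)
    step : Integral (B (suc n))
    step = subst Integral (sym (B-suc n)) (Integral-neg (Integral-* (Integral-rec (suc n) (s≤s n<N))
      (Integral-∑₀ n (λ r r≤n → Integral-* (Integral-ℕ (suc (suc n) C r)) (IH r r≤n)))))

  B-integral : ∀ n → n < N → Integral (B n)
  B-integral n n<N = B-integral-upto n n<N n ℕ.≤-refl

  pow-integral : ∀ k n → Integral (pow k n)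
  pow-integral k n = Integral-ℕ (k ℕ.^ n)

  coef-integral : ∀ n r → n < N → r ≤ n → Integral (coef n r)
  coef-integral n r n<N r≤n = Integral-* (Integral-* (Integral-rec n (s≤s n<N)) (Integral-ℕ (suc n C r))) (B-integral r (ℕ.≤-<-trans r≤n n<N))

  F-integral : ∀ k n → Integral (F k n)
  F-integral zero    n = Integral-ℕ 0
  F-integral (suc k) n = Integral-+ (F-integral k n) (pow-integral k n)

  H-integral : ∀ n → n ≤ N → Integral (H n)
  H-integral n n≤N = subst Integral (sym (H≡∑rec n)) (Integral-∑₁ n (λ k k<n → Integral-rec k (s≤s (ℕ.≤-trans k<n n≤N))))

  powerSum : ℕ → ℚ
  powerSum j = ∑₁ N (λ k → pow k j)

  G-mod-p : ∀ j → j < N → G j p ≡ B j ⟨mod P ⟩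
  G-mod-p zero    _   = ≡⇒mod (trans (*-identityʳ (coef 0 0)) (coef-diag 0))
  G-mod-p (suc j) j<N = mod-trans (mod-+ (mod-trans (mod-∑₀ j lower) (≡⇒mod (∑₀-0 j))) (≡⇒mod top)) (≡⇒mod (+-identityˡ (B (suc j))))
    where
    lower : ∀ r → r ≤ j → coef (suc j) r * pow p (suc j ∸ r) ≡ 0ℚ ⟨mod P ⟩
    lower r r≤j = multiple≡0 {u = coef (suc j) r * pow p (j ∸ r)} (Integral-* (coef-integral (suc j) r j<N (ℕ.m≤n⇒m≤1+n r≤j)) (pow-integral p (j ∸ r)))
      (trans (cong (coef (suc j) r *_) (trans (cong (pow p) (ℕ.+-∸-assoc 1 r≤j)) (pow-suc p (j ∸ r)))) (swap (coef (suc j) r) P (pow p (j ∸ r))))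
      where
      swap : ∀ x y z → x * (y * z) ≡ y * (x * z)
      swap = solve-∀ ℚ-ring
    top : coef (suc j) (suc j) * pow p (j ∸ j) ≡ B (suc j)
    top = trans (cong₂ _*_ (coef-diag (suc j)) (cong (pow p) (ℕ.n∸n≡0 j))) (*-identityʳ (B (suc j)))

  -- As F p j = p G j p, the value of G j p mod p, its constant term B j, suffices. The summand - 1ˢ
  -- j removes the term 0ʲ of F.
  powerSum-mod : ∀ j → j < N → powerSum j ≡ P * B j + - 1ˢ j ⟨mod P * P ⟩
  powerSum-mod j j<N = mod-trans (≡⇒mod eq) (mod-+ (mod-scale P (G-mod-p j j<N)) (≡⇒mod refl))
    where
    lemma : ∀ x y → x ≡ (y + x) + - y
    lemma = solve-∀ ℚ-ring
    eq : powerSum j ≡ P * G j p + - 1ˢ j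
    eq = trans (lemma (powerSum j) (1ˢ j)) (cong (_+ - 1ˢ j) (trans (sym (F≡1ˢ+∑₁ N j)) (faulhaber p j)))

  -- Induction on k by the binomial theorem, with C(p,r+1) written as p times the p-integral number
  -- C(p-1,r)/(r+1).
  fermat : ∀ k → pow k p ≡ ℕ→ℚ k ⟨mod P ⟩
  fermat zero    = ≡⇒mod refl
  fermat (suc k) = mod-trans (≡⇒mod expand) (mod-trans (mod-+ (mod-+ (≡⇒mod (refl {x = 1ℚ})) (mod-trans (mod-∑₀ (suc (suc q)) middle) (≡⇒mod (∑₀-0 (suc (suc q))))))
                     (mod-trans (≡⇒mod top) (fermat k))) (≡⇒mod (trans (cong (_+ ℕ→ℚ k) (+-identityʳ 1ℚ)) (sym (ℕ→ℚ-suc k)))))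
    where
    f : ℕ → ℚ
    f r = ℕ→ℚ (p C r) * pow k r * 1ℚ
    expand : pow (suc k) p ≡ (1ℚ + ∑₀ (suc (suc q)) (f ∘ suc)) + f p
    expand = begin
      pow (suc k) p                                ≡⟨ pow-⋆E k p ⟨
      (pow k ⋆ E) p                                ≡⟨ binomial-∑ (pow k) E p ⟩
      ∑₀ N f + f p                                 ≡⟨ cong (_+ f p) (∑₀-head (suc (suc q)) f) ⟩
      (f 0 + ∑₀ (suc (suc q)) (f ∘ suc)) + f p     ≡⟨⟩
      (1ℚ + ∑₀ (suc (suc q)) (f ∘ suc)) + f p      ∎
    top : f p ≡ pow k p
    top = trans (cong (λ c → ℕ→ℚ c * pow k p * 1ℚ) (nCn≡1 p)) (tidy (pow k p))
      where
      tidy : ∀ x → 1ℚ * x * 1ℚ ≡ x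
      tidy = solve-∀ ℚ-ring
    middle : ∀ r → r ≤ suc (suc q) → f (suc r) ≡ 0ℚ ⟨mod P ⟩
    middle r r≤ = multiple≡0 {u = rec (suc r) * ℕ→ℚ (N C r) * pow k (suc r)}
      (Integral-* (Integral-* (Integral-rec r (s≤s (s≤s r≤))) (Integral-ℕ (N C r))) (pow-integral k (suc r)))
      (begin
        ℕ→ℚ (p C suc r) * pow k (suc r) * 1ℚ
          ≡⟨ cong (λ c → c * pow k (suc r) * 1ℚ) absorb ⟩
        (rec (suc r) * (P * ℕ→ℚ (N C r))) * pow k (suc r) * 1ℚ
          ≡⟨ regroup (rec (suc r)) P (ℕ→ℚ (N C r)) (pow k (suc r)) ⟩
        P * (rec (suc r) * ℕ→ℚ (N C r) * pow k (suc r)) ∎)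
      where
      regroup : ∀ i P c w → (i * (P * c)) * w * 1ℚ ≡ P * (i * c * w)
      regroup = solve-∀ ℚ-ring
      absorb : ℕ→ℚ (p C suc r) ≡ rec (suc r) * (P * ℕ→ℚ (N C r))
      absorb = begin
        ℕ→ℚ (p C suc r)                                       ≡⟨ *-identityˡ (ℕ→ℚ (p C suc r)) ⟨
        1ℚ * ℕ→ℚ (p C suc r)                                  ≡⟨ cong (_* ℕ→ℚ (p C suc r)) (rec-inverseˡ r) ⟨
        (rec (suc r) * ℕ→ℚ (suc r)) * ℕ→ℚ (p C suc r)         ≡⟨ *-assoc (rec (suc r)) (ℕ→ℚ (suc r)) (ℕ→ℚ (p C suc r)) ⟩
        rec (suc r) * (ℕ→ℚ (suc r) * ℕ→ℚ (p C suc r))         ≡⟨ cong (rec (suc r) *_) (ℕ→ℚ-* (suc r) (p C suc r)) ⟨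
        rec (suc r) * ℕ→ℚ (suc r ℕ.* (p C suc r))             ≡⟨ cong (λ z → rec (suc r) * ℕ→ℚ z) ([1+k]*[1+n]C[1+k]≡[1+n]*nCk N r) ⟩
        rec (suc r) * ℕ→ℚ (p ℕ.* (N C r))                     ≡⟨ cong (rec (suc r) *_) (ℕ→ℚ-* p (N C r)) ⟩
        rec (suc r) * (P * ℕ→ℚ (N C r))                       ∎

  -- The exponent suc q is p - 3.
  rec² : ∀ k → k < N → rec (suc k) * rec (suc k) ≡ pow (suc k) (suc q) ⟨mod P ⟩
  -- Multiply kᵖ ≡ k by 1/k³.
  rec² k k<N = mod-sym (mod-trans (≡⇒mod lhs) (mod-trans (mod-*ˡ (Integral-* (Integral-* ir ir) ir) (fermat (suc k))) (≡⇒mod rhs)))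
    where
    r = rec (suc k)
    K = ℕ→ℚ (suc k)
    ir : Integral r
    ir = Integral-rec k (s≤s k<N)
    w = pow (suc k) (suc q)
    lhs : w ≡ r * r * r * pow (suc k) p
    lhs = begin
      w                                   ≡⟨ one w ⟩
      1ℚ * 1ℚ * 1ℚ * w                    ≡⟨ cong (λ z → z * z * z * w) (rec-inverseˡ k) ⟨
      (r * K) * (r * K) * (r * K) * w     ≡⟨ regroup r K w ⟩
      r * r * r * (K * (K * (K * w)))     ≡⟨ cong (λ z → r * r * r * z) (trans (pow-suc (suc k) N) (cong (K *_) (trans (pow-suc (suc k) (suc (suc q))) (cong (K *_) (pow-suc (suc k) (suc q)))))) ⟨
      r * r * r * pow (suc k) p           ∎
      where
      one : ∀ w → w ≡ 1ℚ * 1ℚ * 1ℚ * w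
      one = solve-∀ ℚ-ring
      regroup : ∀ r K w → (r * K) * (r * K) * (r * K) * w ≡ r * r * r * (K * (K * (K * w)))
      regroup = solve-∀ ℚ-ring
    rhs : r * r * r * K ≡ r * r
    rhs = trans (*-assoc (r * r) r K) (trans (cong (r * r *_) (rec-inverseˡ k)) (*-identityʳ (r * r)))

  -- The power sum with exponent p - 3 is p B_{p-3} mod p²: this exponent is positive, so the
  -- correction 1ˢ vanishes, and B_{p-3} is p-integral.
  ∑rec² : ∑₁ N (λ k → rec k * rec k) ≡ 0ℚ ⟨mod P ⟩
  ∑rec² = mod-trans (mod-∑₁ N rec²) (mod-trans (mod-weaken (Integral-ℕ p) (powerSum-mod (suc q) (ℕ.m≤n⇒m≤1+n ℕ.≤-refl)))
            (multiple≡0 {u = B (suc q)} (B-integral (suc q) (ℕ.m≤n⇒m≤1+n ℕ.≤-refl)) (+-identityʳ (P * B (suc q)))))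

  -- Pairing k with p - k writes 2 H_{p-1} as -p times the sum of the 1/k² plus p² times an integral
  -- number; by `∑rec²` the first part is also divisible by p².
  wolstenholme : H N ≡ 0ℚ ⟨mod P * P ⟩
  wolstenholme = mod-trans (≡⇒mod halve) (mod-trans (mod-*ˡ (Integral-rec 1 (s≤s (s≤s (s≤s z≤n)))) twice) (≡⇒mod (*-zeroʳ (rec 2))))
    where
    halve : H N ≡ rec 2 * (2ℚ * H N)
    halve = lemma (H N)
      where
      lemma : ∀ x → x ≡ ½ * (2ℚ * x)
      lemma = solve-∀ ℚ-ring
    g : ℕ → ℚ
    g k = rec k * rec k * rec (p ∸ k)
    pair : ∀ k → k < N → rec (suc k) + rec (p ∸ suc k) ≡ - P * (rec (suc k) * rec (suc k)) + P * P * g (suc k)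
    pair k k<N = begin
      rec (suc k) + rec (p ∸ suc k)             ≡⟨ cong (λ z → rec (suc k) + rec z) c ⟩
      rec (suc k) + rec (suc (N ∸ suc k))       ≡⟨ rec-pair k (N ∸ suc k) ⟩
      - P′ * (rec (suc k) * rec (suc k)) + P′ * P′ * (rec (suc k) * rec (suc k) * rec (suc (N ∸ suc k)))
        ≡⟨ cong₂ (λ x z → - ℕ→ℚ x * (rec (suc k) * rec (suc k)) + ℕ→ℚ x * ℕ→ℚ x * (rec (suc k) * rec (suc k) * rec z)) s (sym c) ⟩
      - P * (rec (suc k) * rec (suc k)) + P * P * g (suc k) ∎
      where
      P′ = ℕ→ℚ (suc k ℕ.+ suc (N ∸ suc k))
      c : p ∸ suc k ≡ suc (N ∸ suc k)
      c = ℕ.+-∸-assoc 1 k<N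
      s : suc k ℕ.+ suc (N ∸ suc k) ≡ p
      s = trans (ℕ.+-suc (suc k) (N ∸ suc k)) (cong suc (ℕ.m+[n∸m]≡n k<N))
    double : 2ℚ * H N ≡ - (P * ∑₁ N (λ k → rec k * rec k)) + P * P * ∑₁ N g
    double = begin
      2ℚ * H N                                            ≡⟨ dbl (H N) ⟩
      H N + H N                                           ≡⟨ cong₂ _+_ (H≡∑rec N) (trans (H≡∑rec N) (∑₁-reverse N rec)) ⟩
      ∑₁ N rec + ∑₁ N (λ k → rec (p ∸ k))                 ≡⟨ ∑₁-+ N rec (λ k → rec (p ∸ k)) ⟨
      ∑₁ N (λ k → rec k + rec (p ∸ k))                    ≡⟨ ∑₁-cong N pair ⟩
      ∑₁ N (λ k → - P * (rec k * rec k) + P * P * g k)    ≡⟨ ∑₁-+ N (λ k → - P * (rec k * rec k)) (λ k → P * P * g k) ⟩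
      ∑₁ N (λ k → - P * (rec k * rec k)) + ∑₁ N (λ k → P * P * g k)
        ≡⟨ cong₂ _+_ (trans (∑₁-*ˡ N (- P) (λ k → rec k * rec k)) (neg P (∑₁ N (λ k → rec k * rec k)))) (∑₁-*ˡ N (P * P) g) ⟩
      - (P * ∑₁ N (λ k → rec k * rec k)) + P * P * ∑₁ N g ∎
      where
      dbl : ∀ x → 2ℚ * x ≡ x + x
      dbl = solve-∀ ℚ-ring
      neg : ∀ x y → - x * y ≡ - (x * y)
      neg = solve-∀ ℚ-ring
    g-integral : Integral (∑₁ N g)
    g-integral = Integral-∑₁ N (λ k k<N → Integral-* (Integral-* (Integral-rec k (s≤s k<N)) (Integral-rec k (s≤s k<N)))
      (subst (λ z → Integral (rec z)) (sym (ℕ.+-∸-assoc 1 k<N)) (Integral-rec (N ∸ suc k) (s≤s (s≤s (ℕ.m∸n≤m (suc (suc q)) k))))))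
    twice : 2ℚ * H N ≡ 0ℚ ⟨mod P * P ⟩
    twice = mod-trans (≡⇒mod double) (mod-trans (mod-+ (mod-neg (mod-scale P ∑rec²)) (multiple≡0 g-integral refl)) (≡⇒mod (tidy P)))
      where
      tidy : ∀ x → - (x * 0ℚ) + 0ℚ ≡ 0ℚ
      tidy = solve-∀ ℚ-ring

  -- The indices n and m are separate because n = m serves the sum of G, and n = m - 1 the sum of
  -- G(k)/k, whose exponents are one lower. The final - `coef m n` comes from the exponent 0.
  ∑coef*powerSum : ∀ n m → (∀ r → r ≤ n → Integral (coef m r)) → n < N →
    ∑₀ n (λ r → coef m r * powerSum (n ∸ r)) ≡ P * (rec (suc m) * ∑₀ n (λ r → ℕ→ℚ (suc m C r) * B r * B (n ∸ r))) + - coef m n ⟨mod P * P ⟩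
  ∑coef*powerSum n m ic n<N = mod-trans (mod-∑₀ n (λ r r≤n → mod-*ˡ (ic r r≤n) (powerSum-mod (n ∸ r) (ℕ.≤-<-trans (ℕ.m∸n≤m n r) n<N)))) (≡⇒mod (begin
    ∑₀ n (λ r → coef m r * (P * B (n ∸ r) + - 1ˢ (n ∸ r)))
      ≡⟨ ∑₀-cong n (λ r _ → expand (rec (suc m)) (ℕ→ℚ (suc m C r)) (B r) P (B (n ∸ r)) (1ˢ (n ∸ r))) ⟩
    ∑₀ n (λ r → P * rec (suc m) * f r + - 1ℚ * (1ˢ (n ∸ r) * coef m r))
      ≡⟨ ∑₀-+ n (λ r → P * rec (suc m) * f r) (λ r → - 1ℚ * (1ˢ (n ∸ r) * coef m r)) ⟩
    ∑₀ n (λ r → P * rec (suc m) * f r) + ∑₀ n (λ r → - 1ℚ * (1ˢ (n ∸ r) * coef m r))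
      ≡⟨ cong₂ _+_ (∑₀-*ˡ n (P * rec (suc m)) f) (trans (∑₀-*ˡ n (- 1ℚ) (λ r → 1ˢ (n ∸ r) * coef m r)) (cong (- 1ℚ *_) (∑₀-diagonal n (coef m)))) ⟩
    P * rec (suc m) * ∑₀ n f + - 1ℚ * coef m n
      ≡⟨ tidy P (rec (suc m)) (∑₀ n f) (coef m n) ⟩
    P * (rec (suc m) * ∑₀ n f) + - coef m n ∎))
    where
    f : ℕ → ℚ
    f r = ℕ→ℚ (suc m C r) * B r * B (n ∸ r)
    expand : ∀ i c b P b′ o → i * c * b * (P * b′ + - o) ≡ P * i * (c * b * b′) + - 1ℚ * (o * (i * c * b))
    expand = solve-∀ ℚ-ring
    tidy : ∀ P i s c → P * i * s + - 1ℚ * c ≡ P * (i * s) + - c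
    tidy = solve-∀ ℚ-ring

  ∑G : ∀ n → ∑₁ N (λ k → G n k) ≡ ∑₀ n (λ r → coef n r * powerSum (n ∸ r))
  ∑G n = trans (∑₁-∑₀-comm N n (λ k r → coef n r * pow k (n ∸ r))) (∑₀-cong n (λ r _ → ∑₁-*ˡ N (coef n r) (λ k → pow k (n ∸ r))))

  ∑kⁿH : ℕ → ℚ
  ∑kⁿH n = ∑₁ N (λ k → pow k n * H k)

  ∑kⁿH-mod : ∀ n → n < N → ∑kⁿH n ≡ B n + - (P * (rec (suc n) * S n)) ⟨mod P * P ⟩
  ∑kⁿH-mod n n<N = mod-trans (≡⇒mod (trans (∑-pow*H N n) (cong (λ z → F p n * H N - z) (∑G n))))
    (mod-trans (mod-+ (mod-trans (mod-*ˡ (F-integral p n) wolstenholme) (≡⇒mod (*-zeroʳ (F p n))))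
                      (mod-neg (∑coef*powerSum n n (λ r → coef-integral n r n<N) n<N)))
      (≡⇒mod (trans (cong (λ c → 0ℚ + - (P * (rec (suc n) * S n) + - c)) (coef-diag n)) (tidy (P * (rec (suc n) * S n)) (B n)))))
    where
    tidy : ∀ x b → 0ℚ + - (x + - b) ≡ b + - x
    tidy = solve-∀ ℚ-ring

  -- Applying `∑kⁿH-mod` with exponent m - r to each term of G brings in 1/(m-r+1), the origin of
  -- the weights in L.
  ∑G*H-mod : ∀ m → m < N → ∑₁ N (λ k → G m k * H k) ≡ rec (suc m) * S m + - (P * (rec (suc m) * L m)) ⟨mod P * P ⟩
  ∑G*H-mod m m<N = mod-trans (≡⇒mod interchange) (mod-trans
    (mod-∑₀ m (λ r r≤m → mod-*ˡ (coef-integral m r m<N r≤m) (∑kⁿH-mod (m ∸ r) (ℕ.≤-<-trans (ℕ.m∸n≤m m r) m<N)))) (≡⇒mod (begin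
    ∑₀ m (λ r → coef m r * (B (m ∸ r) + - (P * (rec (suc (m ∸ r)) * S (m ∸ r)))))
      ≡⟨ ∑₀-cong m (λ r _ → trans (expand i (ℕ→ℚ (suc m C r)) (B r) P (B (m ∸ r)) (rec (suc (m ∸ r))) (S (m ∸ r)))
           (cong (λ c → i * f r + - (P * i) * (c * B r * S (m ∸ r))) (sym (/≡*rec (+ (suc m C r)) (m ∸ r))))) ⟩
    ∑₀ m (λ r → i * f r + - (P * i) * g r)
      ≡⟨ trans (∑₀-+ m (λ r → i * f r) (λ r → - (P * i) * g r)) (cong₂ _+_ (∑₀-*ˡ m i f) (∑₀-*ˡ m (- (P * i)) g)) ⟩
    i * S m + - (P * i) * L m
      ≡⟨ tidy i (S m) P (L m) ⟩
    i * S m + - (P * (i * L m)) ∎)))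
    where
    i = rec (suc m)
    f g : ℕ → ℚ
    f r = ℕ→ℚ (suc m C r) * B r * B (m ∸ r)
    g r = ((+ (suc m C r)) / suc (m ∸ r)) * B r * S (m ∸ r)
    expand : ∀ i c b P b′ r s → i * c * b * (b′ + - (P * (r * s))) ≡ i * (c * b * b′) + - (P * i) * (c * r * b * s)
    expand = solve-∀ ℚ-ring
    tidy : ∀ i s P l → i * s + - (P * i) * l ≡ i * s + - (P * (i * l))
    tidy = solve-∀ ℚ-ring
    interchange : ∑₁ N (λ k → G m k * H k) ≡ ∑₀ m (λ r → coef m r * ∑kⁿH (m ∸ r))
    interchange = begin
      ∑₁ N (λ k → G m k * H k)
        ≡⟨ ∑₁-cong N (λ k _ → trans (*-comm (G m (suc k)) (H (suc k))) (sym (∑₀-*ˡ m (H (suc k)) (λ r → coef m r * pow (suc k) (m ∸ r))))) ⟩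
      ∑₁ N (λ k → ∑₀ m (λ r → H k * (coef m r * pow k (m ∸ r))))
        ≡⟨ ∑₁-∑₀-comm N m (λ k r → H k * (coef m r * pow k (m ∸ r))) ⟩
      ∑₀ m (λ r → ∑₁ N (λ k → H k * (coef m r * pow k (m ∸ r))))
        ≡⟨ ∑₀-cong m (λ r _ → trans (∑₁-cong N (λ k _ → swap (H (suc k)) (coef m r) (pow (suc k) (m ∸ r)))) (∑₁-*ˡ N (coef m r) (λ k → pow k (m ∸ r) * H k))) ⟩
      ∑₀ m (λ r → coef m r * ∑kⁿH (m ∸ r)) ∎
      where
      swap : ∀ h c w → h * (c * w) ≡ c * (w * h)
      swap = solve-∀ ℚ-ring

  -- For m = n + 1 this is the source of the term (m/2) B_{m-1} in the constant part of `T-mod`.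
  coef-subdiag : ∀ n → coef (suc n) n ≡ ½ * ℕ→ℚ (suc n) * B n
  coef-subdiag n = cong (_* B n) (*-cancel-suc 1 {i * c} {½ * M} (begin
    2ℚ * (i * c)                         ≡⟨ swap i c ⟩
    i * (2ℚ * c)                         ≡⟨ cong (i *_) (trans (sym (ℕ→ℚ-* 2 (suc (suc n) C n))) (trans (cong ℕ→ℚ absorb) (ℕ→ℚ-* (suc (suc n)) (suc n)))) ⟩
    i * (ℕ→ℚ (suc (suc n)) * M)          ≡⟨ *-assoc i (ℕ→ℚ (suc (suc n))) M ⟨
    (i * ℕ→ℚ (suc (suc n))) * M          ≡⟨ cong (_* M) (rec-inverseˡ (suc n)) ⟩
    1ℚ * M                               ≡⟨ tidy M ⟩
    2ℚ * (½ * M)                         ∎))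
    where
    i = rec (suc (suc n))
    c = ℕ→ℚ (suc (suc n) C n)
    M = ℕ→ℚ (suc n)
    swap : ∀ i c → 2ℚ * (i * c) ≡ i * (2ℚ * c)
    swap = solve-∀ ℚ-ring
    tidy : ∀ x → 1ℚ * x ≡ 2ℚ * (½ * x)
    tidy = solve-∀ ℚ-ring
    absorb : 2 ℕ.* (suc (suc n) C n) ≡ suc (suc n) ℕ.* suc n
    absorb = trans (cong (λ j → suc j ℕ.* (suc (suc n) C n)) (sym (ℕ.m+n∸n≡m 1 n)))
      (trans ([1+n∸k]*[1+n]Ck≡[1+n]*nCk (suc n) n (ℕ.n≤1+n n)) (cong (suc (suc n) ℕ.*_) ([1+n]Cn≡1+n n)))

  -- Division by k lowers each exponent by one, except in the constant term of G, which contributes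
  -- B_m H_{p-1} and vanishes by `wolstenholme`.
  ∑G*rec-mod : ∀ n → suc n < N → ∑₁ N (λ k → G (suc n) k * rec k) ≡ P * (rec (suc (suc n)) * D (suc n)) + - (½ * ℕ→ℚ (suc n) * B n) ⟨mod P * P ⟩
  ∑G*rec-mod n m<N = mod-trans (≡⇒mod split) (mod-trans
    (mod-+ (∑coef*powerSum n m (λ r r≤n → coef-integral m r m<N (ℕ.m≤n⇒m≤1+n r≤n)) (ℕ.<-trans (ℕ.n<1+n n) m<N))
           (mod-trans (mod-*ˡ (coef-integral m m m<N ℕ.≤-refl) wolstenholme) (≡⇒mod (*-zeroʳ (coef m m)))))
    (≡⇒mod (trans (+-identityʳ _) (cong₂ (λ d c → P * (rec (suc m) * d) + - c) (sym (D≡∑ n)) (coef-subdiag n)))))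
    where
    m = suc n
    term : ∀ k r → r ≤ n → rec (suc k) * (coef m r * pow (suc k) (m ∸ r)) ≡ coef m r * pow (suc k) (n ∸ r)
    term k r r≤n = begin
      rec (suc k) * (coef m r * pow (suc k) (m ∸ r))
        ≡⟨ cong (λ z → rec (suc k) * (coef m r * z)) (trans (cong (pow (suc k)) (ℕ.+-∸-assoc 1 r≤n)) (pow-suc (suc k) (n ∸ r))) ⟩
      rec (suc k) * (coef m r * (ℕ→ℚ (suc k) * pow (suc k) (n ∸ r)))
        ≡⟨ regroup (rec (suc k)) (coef m r) (ℕ→ℚ (suc k)) (pow (suc k) (n ∸ r)) ⟩
      (rec (suc k) * ℕ→ℚ (suc k)) * (coef m r * pow (suc k) (n ∸ r))
        ≡⟨ trans (cong (_* (coef m r * pow (suc k) (n ∸ r))) (rec-inverseˡ k)) (*-identityˡ (coef m r * pow (suc k) (n ∸ r))) ⟩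
      coef m r * pow (suc k) (n ∸ r) ∎
      where
      regroup : ∀ i c k w → i * (c * (k * w)) ≡ (i * k) * (c * w)
      regroup = solve-∀ ℚ-ring
    pointwise : ∀ k → G m (suc k) * rec (suc k) ≡ ∑₀ n (λ r → coef m r * pow (suc k) (n ∸ r)) + coef m m * rec (suc k)
    pointwise k = begin
      (s + coef m m * pow (suc k) (n ∸ n)) * rec (suc k)
        ≡⟨ cong (λ j → (s + coef m m * pow (suc k) j) * rec (suc k)) (ℕ.n∸n≡0 n) ⟩
      (s + coef m m * 1ℚ) * rec (suc k)
        ≡⟨ distrib s (coef m m) (rec (suc k)) ⟩
      rec (suc k) * s + coef m m * rec (suc k)
        ≡⟨ cong (_+ coef m m * rec (suc k)) (trans (sym (∑₀-*ˡ n (rec (suc k)) (λ r → coef m r * pow (suc k) (m ∸ r)))) (∑₀-cong n (term k))) ⟩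
      ∑₀ n (λ r → coef m r * pow (suc k) (n ∸ r)) + coef m m * rec (suc k) ∎
      where
      s = ∑₀ n (λ r → coef m r * pow (suc k) (m ∸ r))
      distrib : ∀ s c r → (s + c * 1ℚ) * r ≡ r * s + c * r
      distrib = solve-∀ ℚ-ring
    split : ∑₁ N (λ k → G m k * rec k) ≡ ∑₀ n (λ r → coef m r * powerSum (n ∸ r)) + coef m m * H N
    split = begin
      ∑₁ N (λ k → G m k * rec k)
        ≡⟨ ∑₁-cong N (λ k _ → pointwise k) ⟩
      ∑₁ N (λ k → ∑₀ n (λ r → coef m r * pow k (n ∸ r)) + coef m m * rec k)
        ≡⟨ ∑₁-+ N (λ k → ∑₀ n (λ r → coef m r * pow k (n ∸ r))) (λ k → coef m m * rec k) ⟩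
      ∑₁ N (λ k → ∑₀ n (λ r → coef m r * pow k (n ∸ r))) + ∑₁ N (λ k → coef m m * rec k)
        ≡⟨ cong₂ _+_ (trans (∑₁-∑₀-comm N n (λ k r → coef m r * pow k (n ∸ r))) (∑₀-cong n (λ r _ → ∑₁-*ˡ N (coef m r) (λ k → pow k (n ∸ r)))))
             (trans (∑₁-*ˡ N (coef m m) rec) (cong (coef m m *_) (sym (H≡∑rec N)))) ⟩
      ∑₀ n (λ r → coef m r * powerSum (n ∸ r)) + coef m m * H N ∎

  T-mod : ∀ n → suc n < N → let m = suc n in
    T p m ≡ (ν m + - (½ * ℕ→ℚ m * B n)) + P * (((+ 2) / suc m) * L m + rec (suc m) * D m) ⟨mod P * P ⟩
  T-mod n m<N = mod-trans (≡⇒mod (trans (∑-pow*H*H N m) (cong (λ z → F p m * (H N * H N) - z) split)))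
    (mod-trans (mod-+ (mod-trans (mod-*ˡ (Integral-* (F-integral p m) (H-integral N ℕ.≤-refl)) wolstenholme) (≡⇒mod (*-zeroʳ (F p m * H N))) ▹ assoc)
      (mod-neg (mod-+ (mod-*ˡ (Integral-ℕ 2) (∑G*H-mod m m<N)) (mod-neg (∑G*rec-mod n m<N)))))
      (≡⇒mod (begin
        0ℚ + - (2ℚ * (i * S m + - (P * (i * L m))) + - (P * (i * D m) + - b))
          ≡⟨ tidy i (S m) P (L m) (D m) b ⟩
        (- (2ℚ * i * S m) + - b) + P * (2ℚ * i * L m + i * D m)
          ≡⟨ cong (λ x → (- (x * S m) + - b) + P * (x * L m + i * D m)) (/≡*rec (+ 2) m) ⟨
        (ν m + - b) + P * (((+ 2) / suc m) * L m + i * D m) ∎)))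
    where
    m = suc n
    i = rec (suc m)
    b = ½ * ℕ→ℚ m * B n
    _▹_ : ∀ {x y z} → x ≡ y ⟨mod P * P ⟩ → z ≡ x → z ≡ y ⟨mod P * P ⟩
    h ▹ e = mod-trans (≡⇒mod e) h
    assoc : F p m * (H N * H N) ≡ F p m * H N * H N
    assoc = sym (*-assoc (F p m) (H N) (H N))
    tidy : ∀ i s P l d b → 0ℚ + - (2ℚ * (i * s + - (P * (i * l))) + - (P * (i * d) + - b)) ≡ (- (2ℚ * i * s) + - b) + P * (2ℚ * i * l + i * d)
    tidy = solve-∀ ℚ-ring
    split : ∑₁ N (λ k → G m k * (2ℚ * H k - rec k)) ≡ 2ℚ * ∑₁ N (λ k → G m k * H k) + - ∑₁ N (λ k → G m k * rec k)
    split = begin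
      ∑₁ N (λ k → G m k * (2ℚ * H k - rec k))
        ≡⟨ ∑₁-cong N (λ k _ → expand (G m (suc k)) (H (suc k)) (rec (suc k))) ⟩
      ∑₁ N (λ k → 2ℚ * (G m k * H k) + - 1ℚ * (G m k * rec k))
        ≡⟨ ∑₁-+ N (λ k → 2ℚ * (G m k * H k)) (λ k → - 1ℚ * (G m k * rec k)) ⟩
      ∑₁ N (λ k → 2ℚ * (G m k * H k)) + ∑₁ N (λ k → - 1ℚ * (G m k * rec k))
        ≡⟨ cong₂ _+_ (∑₁-*ˡ N 2ℚ (λ k → G m k * H k)) (trans (∑₁-*ˡ N (- 1ℚ) (λ k → G m k * rec k)) (neg (∑₁ N (λ k → G m k * rec k)))) ⟩
      2ℚ * ∑₁ N (λ k → G m k * H k) + - ∑₁ N (λ k → G m k * rec k) ∎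
      where
      expand : ∀ g h r → g * (2ℚ * h - r) ≡ 2ℚ * (g * h) + - 1ℚ * (g * r)
      expand = solve-∀ ℚ-ring
      neg : ∀ x → - 1ℚ * x ≡ - x
      neg = solve-∀ ℚ-ring

  T-integral : ∀ m → Integral (T p m)
  T-integral m = Integral-∑₁ N (λ k k<N → Integral-* (Integral-* (pow-integral (suc k) m) (H-integral (suc k) k<N)) (H-integral (suc k) k<N))

  P²-integral : Integral (P * P)
  P²-integral = Integral-* (Integral-ℕ p) (Integral-ℕ p)

  -- The right side inherits its integrality from T through the congruence itself, uniformly for all
  -- the formulas.
  T-≡[mod] : ∀ m y → T p m ≡ y ⟨mod P * P ⟩ → T p m ≡ y [mod p ^ 2 ]
  T-≡[mod] m y h@(congruent u iu e) = ≡⟨mod⟩⇒≡[mod^] 2 (T-integral m) iy (subst (λ z → T p m ≡ y ⟨mod z ⟩) square h)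
    where
    lemma : ∀ y m u → y ≡ (y + m * u) + - (m * u)
    lemma = solve-∀ ℚ-ring
    iy : Integral y
    iy = subst Integral (sym (trans (lemma y (P * P) u) (cong (_+ - (P * P * u)) (sym e)))) (Integral-+ (T-integral m) (Integral-neg (Integral-* P²-integral iu)))
    square : P * P ≡ ℕ→ℚ (p ℕ.^ 2)
    square = trans (sym (ℕ→ℚ-* p p)) (cong (λ z → ℕ→ℚ (p ℕ.* z)) (sym (ℕ.*-identityʳ p)))

  T-odd-mod : ∀ n → suc n < N → sgn n ≡ 1ℚ → n ≢ 2 → T p (suc n) ≡ B n + P * μ (suc n) ⟨mod P * P ⟩
  T-odd-mod n m<N h n≢2 = mod-trans (T-mod n m<N) (≡⇒mod (cong₂ (λ x y → x + P * y) (constant-term-odd n h) (p-coefficient-odd n h n≢2)))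

  T-even-mod : ∀ n → suc (suc n) < N → sgn n ≡ 1ℚ → n ≢ 0 → T p (suc (suc n)) ≡ ν (suc (suc n)) + P * λ′ (suc (suc n)) ⟨mod P * P ⟩
  T-even-mod n m<N h n≢0 = mod-trans (T-mod (suc n) m<N) (≡⇒mod (cong₂ (λ x y → x + P * y)
    -- The term (m/2) B_{m-1} disappears since m - 1 is odd and, as m ≠ 2, different from 1.
    (trans (cong (λ b → ν m + - (½ * ℕ→ℚ m * b)) (B-odd (suc n) (cong -_ h) (λ e → n≢0 (ℕ.suc-injective e)))) (tidy (ν m) (½ * ℕ→ℚ m)))
    (p-coefficient-even n h)))
    where
    m = suc (suc n)
    tidy : ∀ x y → x + - (y * 0ℚ) ≡ x
    tidy = solve-∀ ℚ-ring

  -- Here B_{m-1} = B_1 contributes ½, and ν_2 = -17/18, whence -4/9. Both constants result from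
  -- normalising closed rational terms.
  T-2-mod : T p 2 ≡ ((+ 79) / 108) * P - (+ 4) / 9 ⟨mod P * P ⟩
  T-2-mod = mod-trans (T-mod 1 (s≤s (s≤s (s≤s z≤n)))) (≡⇒mod (trans (cong₂ (λ x y → x + P * y) constant linear) (lemma P)))
    where
    constant : ν 2 + - (½ * ℕ→ℚ 2 * B 1) ≡ - ((+ 4) / 9)
    constant = refl
    linear : ((+ 2) / 3) * L 2 + rec 3 * D 2 ≡ (+ 79) / 108
    linear = refl
    lemma : ∀ P → - ((+ 4) / 9) + P * ((+ 79) / 108) ≡ ((+ 79) / 108) * P - (+ 4) / 9
    lemma = solve-∀ ℚ-ring


  -- Only the coefficient of p is exceptional; the constant 1/6 is B 2, as for the other odd
  -- exponents.
  T-3-mod : 3 < N → T p 3 ≡ (-[1+ 58 ] / 144) * P + (+ 1) / 6 ⟨mod P * P ⟩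
  T-3-mod 3<N = mod-trans (T-mod 2 3<N) (≡⇒mod (trans (cong₂ (λ x y → x + P * y) constant linear) (lemma P)))
    where
    constant : ν 3 + - (½ * ℕ→ℚ 3 * B 2) ≡ (+ 1) / 6
    constant = refl
    linear : ((+ 2) / 4) * L 3 + rec 4 * D 3 ≡ -[1+ 58 ] / 144
    linear = refl
    lemma : ∀ P → (+ 1) / 6 + P * (-[1+ 58 ] / 144) ≡ (-[1+ 58 ] / 144) * P + (+ 1) / 6
    lemma = solve-∀ ℚ-ring

-- Specialisation to primes p at least 5

¬prime[4] : ¬ Prime 4
¬prime[4] pr = [ 4∤2 , 4∤2 ]′ (euclidsLemma 2 2 pr ∣-refl)
  where
  4∤2 : ¬ (4 ∣ 2)
  4∤2 = >⇒∤ (s≤s (s≤s (s≤s z≤n)))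

theorem3p2 : (p : ℕ) → Prime p → 3 < p →
    (T p 2 ≡ ((+ 79) / 108) * ℕ→ℚ p - (+ 4) / 9 [mod p ^ 2 ])
    × (T p 3 ≡ ((-[1+ 58 ]) / 144) * ℕ→ℚ p + (+ 1) / 6 [mod p ^ 2 ])
    × ((m : ℕ) → 0 < m → m < p ∸ 1 →
    (m % 2 ≡ 1 → m ≢ 3 → T p m ≡ B (m ∸ 1) + ℕ→ℚ p * μ m [mod p ^ 2 ])
    × (m % 2 ≡ 0 → m ≢ 2 → T p m ≡ ν m + ℕ→ℚ p * λ′ m [mod p ^ 2 ]))
theorem3p2 zero                              _  ()
theorem3p2 (suc zero)                        _  (s≤s ())
theorem3p2 (suc (suc zero))                  _  (s≤s (s≤s ()))
theorem3p2 (suc (suc (suc zero)))            _  (s≤s (s≤s (s≤s ())))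
-- Excluding 4 supplies the inequality 3 < p - 1 that `T-3-mod` asks for.
theorem3p2 (suc (suc (suc (suc zero))))      pr _ = ⊥-elim (¬prime[4] pr)
theorem3p2 p@(suc (suc (suc (suc (suc q))))) pr _ =
  T-≡[mod] 2 _ T-2-mod , T-≡[mod] 3 _ (T-3-mod (s≤s (s≤s (s≤s (s≤s z≤n))))) , λ m 0<m m<N → odd m 0<m m<N , even m 0<m m<N
  where
  open Congruences (suc q) pr using (N; T-≡[mod]; T-2-mod; T-3-mod; T-odd-mod; T-even-mod)
  odd : ∀ m → 0 < m → m < N → m % 2 ≡ 1 → m ≢ 3 → T p m ≡ B (m ∸ 1) + ℕ→ℚ p * μ m [mod p ^ 2 ]
  odd (suc n) _ m<N h m≢3 = T-≡[mod] (suc n) _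
    (T-odd-mod n m<N (trans (neg-involutive (sgn n)) (cong -_ (sgn-odd (suc n) h))) (λ n≡2 → m≢3 (cong suc n≡2)))
  even : ∀ m → 0 < m → m < N → m % 2 ≡ 0 → m ≢ 2 → T p m ≡ ν m + ℕ→ℚ p * λ′ m [mod p ^ 2 ]
  even (suc zero)    _ _   ()
  even (suc (suc n)) _ m<N h m≢2 = T-≡[mod] (suc (suc n)) _
    (T-even-mod n m<N (sgn-even n h) (λ n≡0 → m≢2 (cong (λ j → suc (suc j)) n≡0)))
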